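{- Let $P$ be a simple polytope and $\mathbf{c}$ a generic cost vector such that $G(P,\mathbf{c})$ is the Hasse diagram of a lattice $L$. Let $F$ be a 2-dimensional face of $P$ with source $u$, and let $x,y\in F$ be vertices both covering $u$ in $L$. Then the pseudo-join of $x,y$ (the sink of the smallest face of $P$ containing $u,x,y$) equals $x\vee y$. Likewise, for any 2-face $F'$ with sink $v$ and vertices $x',y'\in F'$ both covered by $v$ in $L$, the pseudo-meet of $x',y'$ (the source of the smallest face containing $v,x',y'$) equals $x'\wedge y'$.
   Context: A polytope is simple if for each vertex $v$ and each set of $i$ edges at $v$ there is an $i$-dimensional face containing $v$ and those edges. $\mathbf{c}$ is generic if it takes distinct values on distinct vertices of $P$. $G(P,\mathbf{c})$ is the 1-skeleton of $P$ with each edge oriented from the endpoint with smaller $\mathbf{c}$-value to the one with larger $\mathbf{c}$-value. The Hasse diagram of a finite poset has a directed edge $a\to b$ iff $b$ covers $a$. The source (resp. sink) of a face is its vertex minimizing (resp. maximizing) $\mathbf{c}\cdot x$. -}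

module Defs where

open import Level using (0ℓ)
open import Data.Nat using (ℕ; zero; suc)
open import Data.Fin using (Fin; zero; suc)
open import Data.Product using (Σ; ∃; _×_; _,_)
open import Data.Sum using (_⊎_)
open import Relation.Nullary using (¬_)
open import Relation.Binary.PropositionalEquality using (_≡_)
open import Relation.Binary.Structures using (IsTotalOrder)
open import Relation.Binary.Lattice.Bundles using (Lattice)
open import Algebra.Structures using (IsCommutativeRing)

record OrderedField : Set₁ where
  infixl 6 _+_
  infixl 7 _*_
  infix 4 _≤_
  field
    Carrier : Set
    _+_ _*_ : Carrier → Carrier → Carrier
    -_      : Carrier → Carrier
    0# 1#   : Carrier
    _≤_     : Carrier → Carrier → Set
    isCommutativeRing : IsCommutativeRing _≡_ _+_ _*_ -_ 0# 1#
    0≢1     : ¬ (0# ≡ 1#)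
    inverse : ∀ x → ¬ (x ≡ 0#) → ∃ λ y → x * y ≡ 1#
    isTotalOrder : IsTotalOrder _≡_ _≤_
    +-mono-≤ : ∀ {a b} c → a ≤ b → a + c ≤ b + c
    *-nonneg : ∀ {a b} → 0# ≤ a → 0# ≤ b → 0# ≤ a * b

-- Polytope geometry over an ordered field K, in K^d.
-- A polytope is given as the convex hull of finitely many points V.

module Geom (K : OrderedField) where
  open OrderedField K

  infix 4 _<_ _≋_ _∈F_ _⊆F_
  infix 7 _·_

  Pt : ℕ → Set
  Pt d = Fin d → Carrier

  _≋_ : ∀ {d} → Pt d → Pt d → Set
  p ≋ q = ∀ j → p j ≡ q j

  _<_ : Carrier → Carrier → Set
  a < b = a ≤ b × ¬ (a ≡ b)

  sum : ∀ {m} → (Fin m → Carrier) → Carrier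
  sum {zero}  f = 0#
  sum {suc m} f = f zero + sum (λ i → f (suc i))

  _·_ : ∀ {d} → Pt d → Pt d → Carrier
  a · x = sum (λ j → a j * x j)

  InP : ∀ {d m} → (Fin m → Pt d) → Pt d → Set
  InP {d} {m} V x =
    Σ (Fin m → Carrier) λ μ →
      (∀ i → 0# ≤ μ i) × (sum μ ≡ 1#) × (∀ j → x j ≡ sum (λ i → μ i * V i j))

  -- A face of conv(V): given by a valid inequality a·x ≤ b;
  -- the face is conv(V) ∩ {a·x = b}.  (The empty face and P itself are faces.)
  record Face {d m} (V : Fin m → Pt d) : Set where
    constructor face
    field
      normal : Pt d
      level  : Carrier
      valid  : ∀ x → InP V x → normal · x ≤ level

  _∈F_ : ∀ {d m} {V : Fin m → Pt d} → Pt d → Face V → Set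
  _∈F_ {V = V} x (face a b _) = InP V x × (a · x ≡ b)

  _⊆F_ : ∀ {d m} {V : Fin m → Pt d} → Face V → Face V → Set
  F ⊆F G = ∀ x → x ∈F F → x ∈F G

  AffIndep : ∀ {d k} → (Fin k → Pt d) → Set
  AffIndep {d} {k} p =
    ∀ (μ : Fin k → Carrier) → sum μ ≡ 0# →
      (∀ j → sum (λ i → μ i * p i j) ≡ 0#) → ∀ i → μ i ≡ 0#

  HasDim : ∀ {d m} {V : Fin m → Pt d} → Face V → ℕ → Set
  HasDim {d} F n =
    (Σ (Fin (suc n) → Pt d) λ p → (∀ i → p i ∈F F) × AffIndep p) ×
    (∀ (p : Fin (suc (suc n)) → Pt d) → (∀ i → p i ∈F F) → ¬ AffIndep p)

  IsVertex : ∀ {d m} → (Fin m → Pt d) → Pt d → Set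
  IsVertex V v = Σ (Face V) λ F → v ∈F F × (∀ x → x ∈F F → x ≋ v)

  Adjacent : ∀ {d m} → (Fin m → Pt d) → Pt d → Pt d → Set
  Adjacent V u w =
    IsVertex V u × IsVertex V w × ¬ (u ≋ w) ×
    Σ (Face V) λ F → HasDim F 1 × u ∈F F × w ∈F F

  -- simple polytope, as in the paper: for each vertex v and each set of
  -- i edges at v (given by i pairwise distinct neighbours w) there is an
  -- i-dimensional face containing v and those edges.
  IsSimple : ∀ {d m} → (Fin m → Pt d) → Set
  IsSimple {d} V =
    ∀ v → IsVertex V v → ∀ (i : ℕ) (w : Fin i → Pt d) →
      (∀ j k → w j ≋ w k → j ≡ k) → (∀ j → Adjacent V v (w j)) →
      Σ (Face V) λ F → HasDim F i × v ∈F F × (∀ j → w j ∈F F)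

  IsGeneric : ∀ {d m} → (Fin m → Pt d) → Pt d → Set
  IsGeneric V c = ∀ u w → IsVertex V u → IsVertex V w → c · u ≡ c · w → u ≋ w

  DirEdge : ∀ {d m} → (Fin m → Pt d) → Pt d → Pt d → Pt d → Set
  DirEdge V c u w = Adjacent V u w × c · u < c · w

  IsSource : ∀ {d m} {V : Fin m → Pt d} → Pt d → Face V → Pt d → Set
  IsSource {V = V} c F s =
    IsVertex V s × s ∈F F × (∀ w → IsVertex V w → w ∈F F → c · s ≤ c · w)

  IsSink : ∀ {d m} {V : Fin m → Pt d} → Pt d → Face V → Pt d → Set
  IsSink {V = V} c F s =
    IsVertex V s × s ∈F F × (∀ w → IsVertex V w → w ∈F F → c · w ≤ c · s)

  IsSmallestFaceContaining : ∀ {d m k} {V : Fin m → Pt d} →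
    (Fin k → Pt d) → Face V → Set
  IsSmallestFaceContaining {V = V} p G =
    (∀ i → p i ∈F G) × (∀ (H : Face V) → (∀ i → p i ∈F H) → G ⊆F H)

module _ (L : Lattice 0ℓ 0ℓ 0ℓ) where
  open Lattice L

  Covers : Carrier → Carrier → Set
  Covers a b = (a ≤ b × ¬ (a ≈ b)) ×
               (∀ z → a ≤ z → z ≤ b → z ≈ a ⊎ z ≈ b)

-- G(P,c) is the Hasse diagram of L, where ι identifies the elements of L
-- with the vertices of P.
module _ (K : OrderedField) where
  open Geom K

  IsHasseDiagramOf : ∀ {d m} → (Fin m → Pt d) → Pt d →
    (L : Lattice 0ℓ 0ℓ 0ℓ) → (Lattice.Carrier L → Pt d) → Set
  IsHasseDiagramOf V c L ι =
    (∀ a → IsVertex V (ι a)) ×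
    (∀ v → IsVertex V v → ∃ λ a → ι a ≋ v) ×
    (∀ a b → Lattice._≈_ L a b → ι a ≋ ι b) ×
    (∀ a b → ι a ≋ ι b → Lattice._≈_ L a b) ×
    (∀ a b → (Covers L a b → DirEdge V c (ι a) (ι b)) ×
             (DirEdge V c (ι a) (ι b) → Covers L a b))

triple : {A : Set} → A → A → A → Fin 3 → A
triple p q r zero = p
triple p q r (suc zero) = q
triple p q r (suc (suc zero)) = r

{-# OPTIONS --safe #-}
module Submission where

open import Defs
open import Level using (0ℓ)
open import Algebra.Bundles using (CommutativeRing)
import Algebra.Properties.CommutativeMonoid.Sum as CommutativeMonoidSum
import Algebra.Properties.Ring as RingProperties
import Algebra.Properties.Semiring.Sum as SemiringSum
import Algebra.Solver.Ring.NaturalCoefficients.Default as NaturalCoefficients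
open import Data.Bool as Bool using (Bool; true; false)
open import Data.Empty using (⊥; ⊥-elim)
open import Data.Fin using (Fin; zero; suc)
open import Data.Fin.Induction using (spo-wellFounded)
open import Data.Fin.Properties using (any?; all?; ¬∀⟶∃¬)
open import Data.Nat using (ℕ; zero; suc)
open import Data.Product using (Σ; ∃; _×_; _,_; proj₁; proj₂)
open import Data.Sum using (_⊎_; inj₁; inj₂; [_,_]′; swap)
open import Data.Unit using (⊤; tt)
open import Data.Vec.Functional using (_∷_; [])
open import Function using (_∘_; case_of_)
open import Induction.WellFounded using (WellFounded; Acc; acc; module Subrelation)
import Relation.Binary.Construct.On as On
open import Relation.Binary.Lattice.Bundles using (Lattice)
import Relation.Binary.Properties.Poset as PosetProperties
open import Relation.Binary.PropositionalEquality hiding (poset)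
open import Relation.Binary.Structures using (IsTotalOrder)
open import Relation.Nullary using (¬_; Dec; yes; no; contradiction)
open import Relation.Nullary.Decidable using (decidable-stable; _×-dec_; ¬?)

-- Only 2-faces matter. In a 2-face every vertex that is not the sink has an
-- improving edge (take the steepest one), and no vertex has three neighbours.
-- By induction from the top, let F be a 2-face with source u and sink v, and
-- suppose the claim holds at all vertices above u. Then a vertex a ≠ u, v of F
-- has exactly one cover p ≤ v, its upper neighbour in F: another one would,
-- through the 2-faces it spans with edges of F, propagate up to v. So the
-- interval from x to v is a chain inside F, and likewise from y. If x ∨ y were
-- not v, it would have two lower neighbours and an upper one in F.
-- Equality in an ordered field with a totality function is decidable, so all
-- final goals are stable and the argument may be classical.

-- Faces are given only by valid inequalities, so every geometric fact is read off from affine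
-- functions that are nonnegative on a face. Applying such a function to an affine dependence among
-- points gives a scalar relation in which vanishing and positivity fix the signs of the
-- coefficients. Edges likewise come from a finite maximisation: if `g` vanishes only at the vertex
-- `x`, the points of a 2-face where `h / g` is largest form, together with `x`, an edge, provided
-- that `h` is not a multiple of `g` on the face. The lattice part nests two inductions on cost. The
-- outer one is on `u` and ranges over all 2-faces, because the face spanned by a stray cover is a
-- new one; it bounds the sink of that face by `v`. The inner one climbs inside a fixed face.

-- Ordered fields: decidable equality, sign arguments, finite maxima and sums.

module OrderedFieldProperties (K : OrderedField) where
  open OrderedField K
  open Geom K using (_<_; sum)

  commutativeRing : CommutativeRing 0ℓ 0ℓ
  commutativeRing = record { isCommutativeRing = isCommutativeRing }

  open CommutativeRing commutativeRing public
    using ( +-comm; +-assoc; +-identityˡ; +-identityʳ; -‿inverseˡ; -‿inverseʳ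
          ; *-comm; *-assoc; *-identityˡ; *-identityʳ; distribˡ; distribʳ
          ; zeroˡ; zeroʳ)
  private module R = CommutativeRing commutativeRing
  open RingProperties R.ring public
    using (-‿distribˡ-*; -‿involutive; -0#≈0#; -‿+-comm; -1*x≈-x)
  open IsTotalOrder isTotalOrder public
    renaming (refl to ≤-refl; reflexive to ≤-reflexive; trans to ≤-trans; antisym to ≤-antisym; total to ≤-total)
    using ()

  module CommutativeSemiringSolver = NaturalCoefficients R.commutativeSemiring

  infixl 6 _-_
  _-_ : Carrier → Carrier → Carrier
  x - y = x + - y

  x-y+y≡x : ∀ x y → x - y + y ≡ x
  x-y+y≡x x y = trans (+-assoc x (- y) y) (trans (cong (x +_) (-‿inverseˡ y)) (+-identityʳ x))

  x-y≡0⇒x≡y : ∀ x y → x - y ≡ 0# → x ≡ y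
  x-y≡0⇒x≡y x y e = trans (sym (x-y+y≡x x y)) (trans (cong (_+ y) e) (+-identityˡ y))

  x≤y⇒0≤y-x : ∀ {x y} → x ≤ y → 0# ≤ y - x
  x≤y⇒0≤y-x {x} {y} p = subst (_≤ y - x) (-‿inverseʳ x) (+-mono-≤ (- x) p)

  0≤y-x⇒x≤y : ∀ {x y} → 0# ≤ y - x → x ≤ y
  0≤y-x⇒x≤y {x} {y} p = subst₂ _≤_ (+-identityˡ x) (x-y+y≡x y x) (+-mono-≤ x p)

  neg-antimono-≤ : ∀ {x y} → x ≤ y → - y ≤ - x
  neg-antimono-≤ {x} {y} p = 0≤y-x⇒x≤y (subst (0# ≤_) eq (x≤y⇒0≤y-x p))
    where
    eq : y - x ≡ - x - - y
    eq = trans (+-comm y (- x)) (cong (- x +_) (sym (-‿involutive y)))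

  x≤0⇒0≤-x : ∀ {x} → x ≤ 0# → 0# ≤ - x
  x≤0⇒0≤-x p = subst (_≤ _) -0#≈0# (neg-antimono-≤ p)

  0≤-x⇒x≤0 : ∀ {x} → 0# ≤ - x → x ≤ 0#
  0≤-x⇒x≤0 p = subst₂ _≤_ (-‿involutive _) -0#≈0# (neg-antimono-≤ p)

  +-nonneg : ∀ {x y} → 0# ≤ x → 0# ≤ y → 0# ≤ x + y
  +-nonneg {x} {y} p q = ≤-trans q (subst (_≤ x + y) (+-identityˡ y) (+-mono-≤ y p))

  nonneg-sum≡0 : ∀ {x y} → 0# ≤ x → 0# ≤ y → x + y ≡ 0# → x ≡ 0#
  nonneg-sum≡0 {x} {y} p q e =
    ≤-antisym (subst₂ _≤_ (+-identityˡ x) (trans (+-comm y x) e) (+-mono-≤ x q)) p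

  -- Comparing the branch that the totality function takes at 0 with those it
  -- takes at x and at - x decides whether x is 0.
  0≟_ : ∀ x → Dec (x ≡ 0#)
  0≟ x = decide (isNonneg 0# Bool.≟ isNonneg x) (isNonneg 0# Bool.≟ isNonneg (- x))
    where
    isNonneg : Carrier → Bool
    isNonneg y = [ (λ _ → true) , (λ _ → false) ]′ (≤-total 0# y)

    both-signs : isNonneg 0# ≡ isNonneg x → isNonneg 0# ≡ isNonneg (- x) → x ≡ 0#
    both-signs e e′ with ≤-total 0# 0# | ≤-total 0# x | ≤-total 0# (- x)
    ... | inj₁ _ | inj₁ p | inj₁ q = ≤-antisym (0≤-x⇒x≤0 q) p
    ... | inj₂ _ | inj₂ p | inj₂ q =
      ≤-antisym p (subst₂ _≤_ -0#≈0# (-‿involutive x) (neg-antimono-≤ q))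

    decide : Dec (isNonneg 0# ≡ isNonneg x) → Dec (isNonneg 0# ≡ isNonneg (- x)) → Dec (x ≡ 0#)
    decide (yes e) (yes e′) = yes (both-signs e e′)
    decide (no ¬e) _        = no λ { refl → ¬e refl }
    decide (yes _) (no ¬e′) = no λ { refl → ¬e′ (cong isNonneg (sym -0#≈0#)) }

  _≟_ : ∀ x y → Dec (x ≡ y)
  x ≟ y with 0≟ (x - y)
  ... | yes e = yes (x-y≡0⇒x≡y x y e)
  ... | no ¬e = no λ { refl → ¬e (-‿inverseʳ x) }

  <-irrefl : ∀ {x} → ¬ x < x
  <-irrefl (_ , x≢x) = x≢x refl

  <-≤-trans : ∀ {x y z} → x < y → y ≤ z → x < z
  <-≤-trans (p , ne) q = ≤-trans p q , λ { refl → ne (≤-antisym p q) }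

  <⇒≱ : ∀ {x y} → x < y → ¬ y ≤ x
  <⇒≱ p q = <-irrefl (<-≤-trans p q)

  ≰⇒> : ∀ {x y} → ¬ x ≤ y → y < x
  ≰⇒> {x} {y} ¬p with ≤-total x y
  ... | inj₁ p = contradiction p ¬p
  ... | inj₂ q = q , λ { refl → ¬p ≤-refl }

  ≤-or-> : ∀ x y → x ≤ y ⊎ y < x
  ≤-or-> x y with ≤-total x y | x ≟ y
  ... | inj₁ p | _      = inj₁ p
  ... | inj₂ _ | yes e  = inj₁ (≤-reflexive e)
  ... | inj₂ q | no x≢y = inj₂ (q , x≢y ∘ sym)

  neg-antimono-< : ∀ {x y} → x < y → - y < - x
  neg-antimono-< (p , ne) = neg-antimono-≤ p ,
    λ e → ne (sym (trans (sym (-‿involutive _)) (trans (cong -_ e) (-‿involutive _))))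

  x<y⇒0<y-x : ∀ {x y} → x < y → 0# < y - x
  x<y⇒0<y-x {x} {y} (p , ne) = x≤y⇒0≤y-x p , λ e → ne (sym (x-y≡0⇒x≡y y x (sym e)))

  0<y-x⇒x<y : ∀ {x y} → 0# < y - x → x < y
  0<y-x⇒x<y {x} (p , ne) = 0≤y-x⇒x≤y p , λ { refl → ne (sym (-‿inverseʳ x)) }

  -- Total, with the value 0 at 0, so that quotients can be formed at every point of `V` before it
  -- is known where the denominator vanishes.
  inv : Carrier → Carrier
  inv x with 0≟ x
  ... | yes _  = 0#
  ... | no x≢0 = proj₁ (inverse x x≢0)

  x*inv[x]≡1 : ∀ {x} → ¬ x ≡ 0# → x * inv x ≡ 1#
  x*inv[x]≡1 {x} ne with 0≟ x
  ... | yes e  = contradiction e ne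
  ... | no x≢0 = proj₂ (inverse x x≢0)

  y*inv[x]*x≡y : ∀ {x} y → ¬ x ≡ 0# → y * inv x * x ≡ y
  y*inv[x]*x≡y {x} y ne = trans (*-assoc y (inv x) x)
    (trans (cong (y *_) (trans (*-comm (inv x) x) (x*inv[x]≡1 ne))) (*-identityʳ y))

  *-zero-cancelˡ : ∀ {x y} → ¬ x ≡ 0# → x * y ≡ 0# → y ≡ 0#
  *-zero-cancelˡ {x} {y} ne e = begin
    y                ≡⟨ y*inv[x]*x≡y y ne ⟨
    y * inv x * x    ≡⟨ *-comm (y * inv x) x ⟩
    x * (y * inv x)  ≡⟨ *-assoc x y (inv x) ⟨
    x * y * inv x    ≡⟨ cong (_* inv x) e ⟩
    0# * inv x       ≡⟨ zeroˡ (inv x) ⟩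
    0#               ∎
    where open ≡-Reasoning

  *-pos : ∀ {x y} → 0# < x → 0# < y → 0# < x * y
  *-pos (p , ne) (q , ne′) = *-nonneg p q ,
    λ e → ne′ (sym (*-zero-cancelˡ (ne ∘ sym) (sym e)))

  *-pos-cancelʳ : ∀ {x y} → 0# ≤ y → 0# < x * y → 0# < x
  *-pos-cancelʳ {x} {y} 0≤y 0<xy = ≰⇒> λ x≤0 →
    <⇒≱ 0<xy (0≤-x⇒x≤0 (subst (0# ≤_) (sym (-‿distribˡ-* x y)) (*-nonneg (x≤0⇒0≤-x x≤0) 0≤y)))

  *-monoʳ-≤ : ∀ {x y z} → 0# ≤ z → x ≤ y → x * z ≤ y * z
  *-monoʳ-≤ {x} {y} {z} 0≤z x≤y = 0≤y-x⇒x≤y (subst (0# ≤_)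
    (trans (distribʳ z y (- x)) (cong (y * z +_) (sym (-‿distribˡ-* x z))))
    (*-nonneg (x≤y⇒0≤y-x x≤y) 0≤z))

  opposite-≤ : ∀ {α β b c} → 0# < α → 0# < β → b * α + c * β ≡ 0# → 0# ≤ b → c ≤ 0#
  opposite-≤ {α} {β} {b} {c} 0<α 0<β e 0≤b with ≤-total c 0#
  ... | inj₁ c≤0 = c≤0
  ... | inj₂ 0≤c = ≤-reflexive (*-zero-cancelˡ (proj₂ 0<β ∘ sym) (trans (*-comm β c)
    (nonneg-sum≡0 (*-nonneg 0≤c (proj₁ 0<β)) (*-nonneg 0≤b (proj₁ 0<α)) (trans (+-comm _ _) e))))

  opposite-≥ : ∀ {α β b c} → 0# < α → 0# < β → b * α + c * β ≡ 0# → b ≤ 0# → 0# ≤ c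
  opposite-≥ {α} {β} {b} {c} 0<α 0<β e b≤0 =
    subst (0# ≤_) (-‿involutive c) (x≤0⇒0≤-x (opposite-≤ 0<α 0<β e′ (x≤0⇒0≤-x b≤0)))
    where
    open ≡-Reasoning
    e′ : - b * α + - c * β ≡ 0#
    e′ = begin
      - b * α + - c * β      ≡⟨ cong₂ _+_ (-‿distribˡ-* b α) (-‿distribˡ-* c β) ⟨
      - (b * α) - c * β      ≡⟨ -‿+-comm (b * α) (c * β) ⟩
      - (b * α + c * β)      ≡⟨ cong -_ e ⟩
      - 0#                   ≡⟨ -0#≈0# ⟩
      0#                     ∎

  -- The hypotheses say that any two of a, b, c have opposite signs.
  pairwise-opposite⇒0 : ∀ {α α′ β β′ γ γ′ a b c} →
    0# < α → 0# < α′ → 0# < β → 0# < β′ → 0# < γ → 0# < γ′ →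
    b * α + c * α′ ≡ 0# → a * β + c * β′ ≡ 0# → a * γ + b * γ′ ≡ 0# →
    a ≡ 0# × b ≡ 0# × c ≡ 0#
  pairwise-opposite⇒0 {a = a} 0<α 0<α′ 0<β 0<β′ 0<γ 0<γ′ e-bc e-ac e-ab with ≤-total 0# a
  ... | inj₁ 0≤a =
      ≤-antisym (opposite-≤ 0<β′ 0<β (trans (+-comm _ _) e-ac) 0≤c) 0≤a
    , ≤-antisym b≤0 (opposite-≥ 0<α′ 0<α (trans (+-comm _ _) e-bc) c≤0)
    , ≤-antisym c≤0 0≤c
    where
    b≤0 = opposite-≤ 0<γ 0<γ′ e-ab 0≤a
    c≤0 = opposite-≤ 0<β 0<β′ e-ac 0≤a
    0≤c = opposite-≥ 0<α 0<α′ e-bc b≤0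
  ... | inj₂ a≤0 =
      ≤-antisym a≤0 (opposite-≥ 0<β′ 0<β (trans (+-comm _ _) e-ac) c≤0)
    , ≤-antisym (opposite-≤ 0<α′ 0<α (trans (+-comm _ _) e-bc) 0≤c) 0≤b
    , ≤-antisym c≤0 0≤c
    where
    0≤b = opposite-≥ 0<γ 0<γ′ e-ab a≤0
    0≤c = opposite-≥ 0<β 0<β′ e-ac a≤0
    c≤0 = opposite-≤ 0<α 0<α′ e-bc 0≤b

  maximize : ∀ {n} {P : Fin n → Set} → (∀ i → Dec (P i)) → (f : Fin n → Carrier) →
    ∃ P → ∃ λ i → P i × (∀ j → P j → f j ≤ f i)
  maximize {zero}  P? f (() , _)
  maximize {suc n} P? f (k , Pk) with any? (P? ∘ suc)
  maximize {suc n} P? f (zero , P0) | no ∄ = zero , P0 ,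
    λ { zero _ → ≤-refl ; (suc j) Pj → contradiction (j , Pj) ∄ }
  maximize {suc n} P? f (suc k , Pk) | no ∄ = contradiction (k , Pk) ∄
  ... | yes ∃P with maximize (P? ∘ suc) (f ∘ suc) ∃P | P? zero
  ...   | i , Pi , max | no ¬P0 = suc i , Pi ,
    λ { zero P0 → contradiction P0 ¬P0 ; (suc j) → max j }
  ...   | i , Pi , max | yes P0 with ≤-total (f zero) (f (suc i))
  ...     | inj₁ p = suc i , Pi , λ { zero _ → p ; (suc j) → max j }
  ...     | inj₂ q = zero , P0 , λ { zero _ → ≤-refl ; (suc j) Pj → ≤-trans (max j Pj) q }

  upperBound : ∀ {n} (f : Fin n → Carrier) → ∃ λ N → ∀ i → f i ≤ N
  upperBound {zero}  f = 0# , λ ()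
  upperBound {suc n} f with maximize {P = λ _ → ⊤} (λ _ → yes tt) f (zero , tt)
  ... | i , _ , max = f i , λ j → max j tt

  private
    module MS = CommutativeMonoidSum R.+-commutativeMonoid
    module SS = SemiringSum R.semiring

    sum≡ : ∀ {n} (f : Fin n → Carrier) → sum f ≡ MS.sum f
    sum≡ {zero}  f = refl
    sum≡ {suc n} f = cong (f zero +_) (sum≡ (f ∘ suc))

  sum-cong : ∀ {n} {f g : Fin n → Carrier} → (∀ i → f i ≡ g i) → sum f ≡ sum g
  sum-cong {zero}  e = refl
  sum-cong {suc n} e = cong₂ _+_ (e zero) (sum-cong (e ∘ suc))

  sum-+ : ∀ {n} (f g : Fin n → Carrier) → sum (λ i → f i + g i) ≡ sum f + sum g
  sum-+ {n} f g = trans (sum≡ {n} _) (trans (MS.∑-distrib-+ f g) (sym (cong₂ _+_ (sum≡ f) (sum≡ g))))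

  sum-*ˡ : ∀ {n} x (f : Fin n → Carrier) → sum (λ i → x * f i) ≡ x * sum f
  sum-*ˡ {n} x f = trans (sum≡ {n} _) (trans (sym (SS.*-distribˡ-sum x f)) (cong (x *_) (sym (sum≡ f))))

  sum-*ʳ : ∀ {n} x (f : Fin n → Carrier) → sum (λ i → f i * x) ≡ sum f * x
  sum-*ʳ {n} x f = trans (sum≡ {n} _) (trans (sym (SS.*-distribʳ-sum x f)) (cong (_* x) (sym (sum≡ f))))

  sum-swap : ∀ {m n} (f : Fin m → Fin n → Carrier) →
    sum (λ i → sum (f i)) ≡ sum (λ j → sum (λ i → f i j))
  sum-swap {m} {n} f = trans (sum-cong (λ i → sum≡ (f i))) (trans (sum≡ {m} _) (trans (MS.∑-comm f)
    (sym (trans (sum-cong (λ j → sum≡ (λ i → f i j))) (sum≡ {n} _)))))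

  sum-zero : ∀ {n} {f : Fin n → Carrier} → (∀ i → f i ≡ 0#) → sum f ≡ 0#
  sum-zero {zero}  e = refl
  sum-zero {suc n} e = trans (cong₂ _+_ (e zero) (sum-zero (e ∘ suc))) (+-identityˡ 0#)

  sum-nonneg : ∀ {n} {f : Fin n → Carrier} → (∀ i → 0# ≤ f i) → 0# ≤ sum f
  sum-nonneg {zero}  p = ≤-refl
  sum-nonneg {suc n} p = +-nonneg (p zero) (sum-nonneg (p ∘ suc))

  sum-nonneg≡0 : ∀ {n} {f : Fin n → Carrier} → (∀ i → 0# ≤ f i) → sum f ≡ 0# → ∀ i → f i ≡ 0#
  sum-nonneg≡0 p e zero    = nonneg-sum≡0 (p zero) (sum-nonneg (p ∘ suc)) e
  sum-nonneg≡0 p e (suc i) = sum-nonneg≡0 (p ∘ suc)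
    (nonneg-sum≡0 (sum-nonneg (p ∘ suc)) (p zero) (trans (+-comm _ _) e)) i

  0<1 : 0# < 1#
  0<1 with ≤-total 0# 1#
  ... | inj₁ p = p , 0≢1
  ... | inj₂ q = subst (0# ≤_) -1*-1≡1 (*-nonneg (x≤0⇒0≤-x q) (x≤0⇒0≤-x q)) , 0≢1
    where
    -1*-1≡1 : - 1# * - 1# ≡ 1#
    -1*-1≡1 = trans (sym (-‿distribˡ-* 1# (- 1#)))
      (trans (cong -_ (*-identityˡ (- 1#))) (-‿involutive 1#))

  -- The Kronecker delta. It serves both as the convex weights of a point `V i` and as the normal of
  -- a coordinate function.
  δ : ∀ {n} → Fin n → Fin n → Carrier
  δ zero    zero    = 1#
  δ zero    (suc _) = 0#
  δ (suc _) zero    = 0#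
  δ (suc i) (suc j) = δ i j

  δ-nonneg : ∀ {n} (i j : Fin n) → 0# ≤ δ i j
  δ-nonneg zero    zero    = proj₁ 0<1
  δ-nonneg zero    (suc _) = ≤-refl
  δ-nonneg (suc _) zero    = ≤-refl
  δ-nonneg (suc i) (suc j) = δ-nonneg i j

  sum-δ : ∀ {n} (i : Fin n) (f : Fin n → Carrier) → sum (λ j → δ i j * f j) ≡ f i
  sum-δ zero    f = trans (cong₂ _+_ (*-identityˡ _) (sum-zero λ j → zeroˡ (f (suc j)))) (+-identityʳ _)
  sum-δ (suc i) f = trans (cong₂ _+_ (zeroˡ _) (sum-δ i (f ∘ suc))) (+-identityˡ _)

-- Affine functions and the faces they cut out.

module PolytopeGeometry (K : OrderedField) {d m : ℕ} (V : Fin m → Geom.Pt K d) where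
  open OrderedField K
  open OrderedFieldProperties K
  open Geom K

  ≋-sym : {p q : Pt d} → p ≋ q → q ≋ p
  ≋-sym e j = sym (e j)

  ≋-trans : {p q r : Pt d} → p ≋ q → q ≋ r → p ≋ r
  ≋-trans e e′ j = trans (e j) (e′ j)

  _≋?_ : (p q : Pt d) → Dec (p ≋ q)
  p ≋? q = all? λ j → p j ≟ q j

  ·-cong : ∀ a {p q : Pt d} → p ≋ q → a · p ≡ a · q
  ·-cong a e = sum-cong λ j → cong (a j *_) (e j)

  neg-· : (a p : Pt d) → (λ j → - a j) · p ≡ - (a · p)
  neg-· a p = trans (sum-cong λ j → trans (cong (_* p j) (sym (-1*x≈-x (a j)))) (*-assoc _ _ _))
    (trans (sum-*ˡ {d} (- 1#) _) (-1*x≈-x (a · p)))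

  record Affine : Set where
    constructor affine
    field
      linear   : Pt d
      constant : Carrier

    ⟦_⟧ : Pt d → Carrier
    ⟦_⟧ p = linear · p + constant

    ⟦⟧-cong : ∀ {p q} → p ≋ q → ⟦_⟧ p ≡ ⟦_⟧ q
    ⟦⟧-cong e = cong (_+ constant) (·-cong linear e)

    -- The constant term is scaled by the total weight: weight 0 gives the rule for dependences,
    -- weight 1 the rule for convex combinations.
    ⟦⟧-combination : ∀ {k} (μ : Fin k → Carrier) (p : Fin k → Pt d) →
      sum (λ i → μ i * ⟦_⟧ (p i)) ≡ linear · (λ j → sum (λ i → μ i * p i j)) + sum μ * constant
    ⟦⟧-combination {k} μ p = begin
      sum (λ i → μ i * (linear · p i + constant))
        ≡⟨ sum-cong (λ i → distribˡ (μ i) _ _) ⟩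
      sum (λ i → μ i * (linear · p i) + μ i * constant)
        ≡⟨ sum-+ {k} _ _ ⟩
      sum (λ i → μ i * (linear · p i)) + sum (λ i → μ i * constant)
        ≡⟨ cong₂ _+_ (sum-cong λ i → sym (sum-*ˡ {d} (μ i) _)) (sum-*ʳ constant μ) ⟩
      sum (λ i → sum (λ j → μ i * (linear j * p i j))) + sum μ * constant
        ≡⟨ cong (_+ sum μ * constant) (sum-swap {k} {d} _) ⟩
      sum (λ j → sum (λ i → μ i * (linear j * p i j))) + sum μ * constant
        ≡⟨ cong (_+ sum μ * constant) (sum-cong λ j →
             trans (sum-cong λ i → x*[y*z]≡y*[x*z] (μ i) (linear j) (p i j)) (sum-*ˡ {k} (linear j) _)) ⟩
      linear · (λ j → sum (λ i → μ i * p i j)) + sum μ * constant ∎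
      where
      open ≡-Reasoning
      x*[y*z]≡y*[x*z] : ∀ x y z → x * (y * z) ≡ y * (x * z)
      x*[y*z]≡y*[x*z] x y z = trans (sym (*-assoc x y z))
        (trans (cong (_* z) (*-comm x y)) (*-assoc y x z))

    ⟦⟧-dependence : ∀ {k} (μ : Fin k → Carrier) (p : Fin k → Pt d) →
      sum μ ≡ 0# → (∀ j → sum (λ i → μ i * p i j) ≡ 0#) → sum (λ i → μ i * ⟦_⟧ (p i)) ≡ 0#
    ⟦⟧-dependence μ p Σμ≡0 Σμp≡0 = trans (⟦⟧-combination μ p)
      (trans (cong₂ _+_ (sum-zero λ j → trans (cong (linear j *_) (Σμp≡0 j)) (zeroʳ _))
        (trans (cong (_* constant) Σμ≡0) (zeroˡ _))) (+-identityˡ 0#))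

    ⟦⟧-convex : ∀ {x} ((μ , _) : InP V x) → ⟦_⟧ x ≡ sum (λ i → μ i * ⟦_⟧ (V i))
    ⟦⟧-convex (μ , _ , Σμ≡1 , x≡ΣμV) = trans
      (cong₂ _+_ (·-cong linear x≡ΣμV) (sym (trans (cong (_* constant) Σμ≡1) (*-identityˡ constant))))
      (sym (⟦⟧-combination μ V))

    ⟦⟧-nonneg : (∀ i → 0# ≤ ⟦_⟧ (V i)) → ∀ {x} → InP V x → 0# ≤ ⟦_⟧ x
    ⟦⟧-nonneg p x∈P@(_ , 0≤μ , _) = subst (0# ≤_) (sym (⟦⟧-convex x∈P))
      (sum-nonneg λ i → *-nonneg (0≤μ i) (p i))

    -- A vanishing sum of nonnegative terms has only zero terms. So a zero of the function puts no
    -- weight on the `V i` where it is positive.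
    ⟦⟧-support : (∀ i → 0# ≤ ⟦_⟧ (V i)) → ∀ {x} ((μ , _) : InP V x) → ⟦_⟧ x ≡ 0# →
      ∀ i → μ i * ⟦_⟧ (V i) ≡ 0#
    ⟦⟧-support p x∈P@(_ , 0≤μ , _) e = sum-nonneg≡0 (λ i → *-nonneg (0≤μ i) (p i))
      (trans (sym (⟦⟧-convex x∈P)) e)

  open Affine

  infixl 6 _⊕_
  infixl 7 _⊛_

  _⊕_ : Affine → Affine → Affine
  affine a b ⊕ affine a′ b′ = affine (λ j → a j + a′ j) (b + b′)

  ⟦⊕⟧ : ∀ φ ψ p → ⟦ φ ⊕ ψ ⟧ p ≡ ⟦ φ ⟧ p + ⟦ ψ ⟧ p
  ⟦⊕⟧ (affine a b) (affine a′ b′) p = trans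
    (cong (_+ (b + b′)) (trans (sum-cong λ j → distribʳ (p j) (a j) (a′ j)) (sum-+ {d} _ _)))
    (interchange (a · p) (a′ · p) b b′)
    where
    interchange : ∀ w x y z → w + x + (y + z) ≡ w + y + (x + z)
    interchange w x y z = trans (+-assoc w x (y + z)) (trans (cong (w +_)
      (trans (sym (+-assoc x y z)) (trans (cong (_+ z) (+-comm x y)) (+-assoc y x z))))
      (sym (+-assoc w y (x + z))))

  _⊛_ : Carrier → Affine → Affine
  k ⊛ affine a b = affine (λ j → k * a j) (k * b)

  ⟦⊛⟧ : ∀ k φ p → ⟦ k ⊛ φ ⟧ p ≡ k * ⟦ φ ⟧ p
  ⟦⊛⟧ k (affine a b) p = trans
    (cong (_+ k * b) (trans (sum-cong λ j → *-assoc k (a j) (p j)) (sum-*ˡ {d} k _)))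
    (sym (distribˡ k (a · p) b))

  ⊖_ : Affine → Affine
  ⊖ φ = - 1# ⊛ φ

  ⟦⊖⟧ : ∀ φ p → ⟦ ⊖ φ ⟧ p ≡ - ⟦ φ ⟧ p
  ⟦⊖⟧ φ p = trans (⟦⊛⟧ (- 1#) φ p) (-1*x≈-x _)

  const : Carrier → Affine
  const k = affine (λ _ → 0#) k

  ⟦const⟧ : ∀ k p → ⟦ const k ⟧ p ≡ k
  ⟦const⟧ k p = trans (cong (_+ k) (sum-zero λ j → zeroˡ (p j))) (+-identityˡ k)

  centred : Pt d → Pt d → Affine
  centred c x = affine c (- (c · x))

  coordinate : Fin d → Pt d → Affine
  coordinate j x = affine (δ j) (- x j)

  ⟦coordinate⟧ : ∀ j x p → ⟦ coordinate j x ⟧ p ≡ p j - x j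
  ⟦coordinate⟧ j x p = cong (_+ - x j) (sum-δ j p)

  InP-cong : ∀ {p q} → p ≋ q → InP V p → InP V q
  InP-cong e (μ , 0≤μ , Σμ≡1 , p≡) = μ , 0≤μ , Σμ≡1 , λ j → trans (sym (e j)) (p≡ j)

  V∈P : ∀ i → InP V (V i)
  V∈P i = δ i , δ-nonneg i , trans (sum-cong λ j → sym (*-identityʳ (δ i j))) (sum-δ i λ _ → 1#)
    , λ j → sym (sum-δ i λ k → V k j)

  ∈F-cong : (F : Face V) → ∀ {p q} → p ≋ q → p ∈F F → q ∈F F
  ∈F-cong F e (p∈P , a·p≡b) = InP-cong e p∈P , trans (·-cong _ (≋-sym e)) a·p≡b

  slack : Face V → Affine
  slack (face a b _) = affine (λ j → - a j) b

  ⟦slack⟧ : ∀ F p → ⟦ slack F ⟧ p ≡ Face.level F - Face.normal F · p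
  ⟦slack⟧ F p = trans (cong (_+ Face.level F) (neg-· (Face.normal F) p)) (+-comm _ _)

  slack-nonneg : ∀ F {p} → InP V p → 0# ≤ ⟦ slack F ⟧ p
  slack-nonneg F {p} p∈P = subst (0# ≤_) (sym (⟦slack⟧ F p)) (x≤y⇒0≤y-x (Face.valid F p p∈P))

  ∈F⇒slack≡0 : ∀ F {p} → p ∈F F → ⟦ slack F ⟧ p ≡ 0#
  ∈F⇒slack≡0 F {p} (_ , e) = trans (⟦slack⟧ F p) (trans (cong (λ z → Face.level F - z) e) (-‿inverseʳ _))

  slack≡0⇒∈F : ∀ F {p} → InP V p → ⟦ slack F ⟧ p ≡ 0# → p ∈F F
  slack≡0⇒∈F F {p} p∈P e = p∈P , sym (x-y≡0⇒x≡y _ _ (trans (sym (⟦slack⟧ F p)) e))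

  ∉F⇒0<slack : ∀ F {p} → InP V p → ¬ p ∈F F → 0# < ⟦ slack F ⟧ p
  ∉F⇒0<slack F p∈P p∉F = slack-nonneg F p∈P , λ e → p∉F (slack≡0⇒∈F F p∈P (sym e))

  -- Restricted to the listed points: these are known to lie in `P`, so that only an equation in the
  -- field has to be decided.
  ∈F? : ∀ F i → Dec (V i ∈F F)
  ∈F? F i with 0≟ (⟦ slack F ⟧ (V i))
  ... | yes e = yes (slack≡0⇒∈F F (V∈P i) e)
  ... | no ¬e = no λ V∈F → ¬e (∈F⇒slack≡0 F V∈F)

  zeroFace : (φ : Affine) → (∀ i → 0# ≤ ⟦ φ ⟧ (V i)) → Face V
  zeroFace φ 0≤φ = face (λ j → - linear φ j) (constant φ) λ x x∈P →
    0≤y-x⇒x≤y (subst (0# ≤_) (eq x) (⟦⟧-nonneg φ 0≤φ x∈P))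
    where
    eq : ∀ x → ⟦ φ ⟧ x ≡ constant φ - (λ j → - linear φ j) · x
    eq x = trans (+-comm _ _) (cong (constant φ +_)
      (sym (trans (cong -_ (neg-· (linear φ) x)) (-‿involutive _))))

  ⟦slack-zeroFace⟧ : ∀ φ 0≤φ x → ⟦ slack (zeroFace φ 0≤φ) ⟧ x ≡ ⟦ φ ⟧ x
  ⟦slack-zeroFace⟧ φ 0≤φ x = cong (_+ constant φ)
    (sum-cong λ j → cong (_* x j) (-‿involutive (linear φ j)))

  -- A face of the face F is a face of P: φ plus a large multiple of the slack
  -- of F is nonnegative on P and vanishes on F only where φ does.
  subface : (F : Face V) (φ : Affine) → (∀ i → V i ∈F F → 0# ≤ ⟦ φ ⟧ (V i)) →
    Σ (Face V) λ E → (∀ {x} → x ∈F F → ⟦ φ ⟧ x ≡ 0# → x ∈F E) ×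
                     (∀ {x} → x ∈F E → x ∈F F × ⟦ φ ⟧ x ≡ 0#)
  subface F φ 0≤φ = E , into , out
    where
    σ = slack F
    -- The quotient is what `N` must reach to make `ψ` at least 1 at a `V i` outside `F`. At a `V i`
    -- in `F` the slack is 0 and the entry is a harmless 0.
    bound = upperBound λ i → (1# - ⟦ φ ⟧ (V i)) * inv (⟦ σ ⟧ (V i))
    N = proj₁ bound
    ψ = φ ⊕ N ⊛ σ

    ⟦ψ⟧ : ∀ x → ⟦ ψ ⟧ x ≡ ⟦ φ ⟧ x + N * ⟦ σ ⟧ x
    ⟦ψ⟧ x = trans (⟦⊕⟧ φ (N ⊛ σ) x) (cong (⟦ φ ⟧ x +_) (⟦⊛⟧ N σ x))

    ⟦ψ⟧-on-F : ∀ {x} → x ∈F F → ⟦ ψ ⟧ x ≡ ⟦ φ ⟧ x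
    ⟦ψ⟧-on-F x∈F = trans (⟦ψ⟧ _) (trans
      (cong (⟦ φ ⟧ _ +_) (trans (cong (N *_) (∈F⇒slack≡0 F x∈F)) (zeroʳ N))) (+-identityʳ _))

    0<ψ : ∀ i → ¬ V i ∈F F → 0# < ⟦ ψ ⟧ (V i)
    0<ψ i V∉F = <-≤-trans 0<1 (subst₂ _≤_ (x-y+y≡x 1# φᵢ)
      (trans (+-comm _ φᵢ) (sym (⟦ψ⟧ (V i)))) (+-mono-≤ φᵢ 1-φᵢ≤Nσᵢ))
      where
      φᵢ = ⟦ φ ⟧ (V i)
      0<σᵢ = ∉F⇒0<slack F (V∈P i) V∉F

      1-φᵢ≤Nσᵢ : 1# - φᵢ ≤ N * ⟦ σ ⟧ (V i)
      1-φᵢ≤Nσᵢ = subst (_≤ N * ⟦ σ ⟧ (V i)) (y*inv[x]*x≡y (1# - φᵢ) (proj₂ 0<σᵢ ∘ sym))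
        (*-monoʳ-≤ (proj₁ 0<σᵢ) (proj₂ bound i))

    0≤ψ : ∀ i → 0# ≤ ⟦ ψ ⟧ (V i)
    0≤ψ i with ∈F? F i
    ... | yes V∈F = subst (0# ≤_) (sym (⟦ψ⟧-on-F V∈F)) (0≤φ i V∈F)
    ... | no V∉F  = proj₁ (0<ψ i V∉F)

    E = zeroFace ψ 0≤ψ

    into : ∀ {x} → x ∈F F → ⟦ φ ⟧ x ≡ 0# → x ∈F E
    into x∈F e = slack≡0⇒∈F E (proj₁ x∈F) (trans (⟦slack-zeroFace⟧ ψ 0≤ψ _) (trans (⟦ψ⟧-on-F x∈F) e))

    out : ∀ {x} → x ∈F E → x ∈F F × ⟦ φ ⟧ x ≡ 0#
    out {x} x∈E@(x∈P@(μ , _) , _) = x∈F , trans (sym (⟦ψ⟧-on-F x∈F)) ψx≡0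
      where
      ψx≡0 : ⟦ ψ ⟧ x ≡ 0#
      ψx≡0 = trans (sym (⟦slack-zeroFace⟧ ψ 0≤ψ x)) (∈F⇒slack≡0 E x∈E)

      -- A zero of `ψ` gives weight 0 to the `V i` outside `F`, where `ψ` is positive; inside `F`
      -- the slack is 0.
      μσ≡0 : ∀ i → μ i * ⟦ σ ⟧ (V i) ≡ 0#
      μσ≡0 i with ∈F? F i
      ... | yes V∈F = trans (cong (μ i *_) (∈F⇒slack≡0 F V∈F)) (zeroʳ _)
      ... | no V∉F  = trans (cong (_* ⟦ σ ⟧ (V i)) (*-zero-cancelˡ (proj₂ (0<ψ i V∉F) ∘ sym)
        (trans (*-comm _ _) (⟦⟧-support ψ 0≤ψ x∈P ψx≡0 i)))) (zeroˡ _)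

      x∈F : x ∈F F
      x∈F = slack≡0⇒∈F F x∈P (trans (⟦⟧-convex σ x∈P) (sum-zero μσ≡0))

  -- In a convex combination giving a point of `F`, the `V i` outside `F` have positive slack and
  -- hence weight 0.
  V-zero⇒F-zero : ∀ F φ → (∀ i → V i ∈F F → ⟦ φ ⟧ (V i) ≡ 0#) → ∀ {p} → p ∈F F → ⟦ φ ⟧ p ≡ 0#
  V-zero⇒F-zero F φ φV≡0 {p} p∈F@(p∈P@(μ , _) , _) =
    trans (⟦⟧-convex φ p∈P) (sum-zero μφ≡0)
    where
    μφ≡0 : ∀ i → μ i * ⟦ φ ⟧ (V i) ≡ 0#
    μφ≡0 i with ∈F? F i
    ... | yes V∈F = trans (cong (μ i *_) (φV≡0 i V∈F)) (zeroʳ _)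
    ... | no V∉F  = trans (cong (_* ⟦ φ ⟧ (V i)) (*-zero-cancelˡ
      (proj₂ (∉F⇒0<slack F (V∈P i) V∉F) ∘ sym)
      (trans (*-comm _ _) (⟦⟧-support (slack F) (λ i → slack-nonneg F (V∈P i)) p∈P (∈F⇒slack≡0 F p∈F) i))))
      (zeroˡ _)

  -- Affine independence.

  -- Applying `θ` to a dependence leaves only the term of `q`, so its coefficient is 0 and the rest
  -- is a dependence of `p`.
  AffIndep-∷ : ∀ {k} {p : Fin k → Pt d} θ → (∀ i → ⟦ θ ⟧ (p i) ≡ 0#) →
    ∀ {q} → ¬ ⟦ θ ⟧ q ≡ 0# → AffIndep p → AffIndep (q ∷ p)
  AffIndep-∷ {p = p} θ θp≡0 {q} θq≢0 indep μ Σμ≡0 Σμp≡0 =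
    λ { zero → μ₀≡0 ; (suc i) → indep (μ ∘ suc) (drop₀ μ₀≡0 Σμ≡0)
      (λ j → drop₀ (trans (cong (_* q j) μ₀≡0) (zeroˡ _)) (Σμp≡0 j)) i }
    where
    drop₀ : ∀ {x y} → x ≡ 0# → x + y ≡ 0# → y ≡ 0#
    drop₀ refl e = trans (sym (+-identityˡ _)) e

    μ₀≡0 : μ zero ≡ 0#
    μ₀≡0 = *-zero-cancelˡ θq≢0 (trans (*-comm _ _) (drop₀
      (sum-zero λ i → trans (cong (μ (suc i) *_) (θp≡0 i)) (zeroʳ _))
      (trans (+-comm _ _) (⟦⟧-dependence θ μ (q ∷ p) Σμ≡0 Σμp≡0))))

  AffIndep-pair : ∀ {p q} → ¬ p ≋ q → AffIndep (p ∷ q ∷ [])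
  AffIndep-pair {p} {q} p≉q with ¬∀⟶∃¬ d _ (λ j → p j ≟ q j) p≉q
  ... | j , pj≢qj = AffIndep-∷ {p = q ∷ []} (coordinate j q)
    (λ { zero → trans (⟦coordinate⟧ j q q) (-‿inverseʳ (q j)) })
    (λ e → pj≢qj (x-y≡0⇒x≡y _ _ (trans (sym (⟦coordinate⟧ j q p)) e)))
    (λ { μ Σμ≡0 _ zero → trans (sym (+-identityʳ (μ zero))) Σμ≡0 })

  -- A dependence among the parameters `s` is one among the points, and a nontrivial one exists
  -- whether or not the parameters differ.
  collinear⇒¬AffIndep : (x w : Pt d) (s : Fin 3 → Carrier) {p : Fin 3 → Pt d} →
    (∀ i j → p i j ≡ x j + s i * w j) → ¬ AffIndep p
  collinear⇒¬AffIndep x w s {p} p≡x+sw indep = 0≢1 (sym (independent μ′ Σμ′≡0 Σμ′s≡0 zero))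
    where
    open CommutativeSemiringSolver
    s₀ = s zero
    s₁ = s (suc zero)
    s₂ = s (suc (suc zero))

    independent : ∀ μ → sum μ ≡ 0# → sum (λ i → μ i * s i) ≡ 0# → ∀ i → μ i ≡ 0#
    independent μ Σμ≡0 Σμs≡0 = indep μ Σμ≡0 λ j → trans
      (sum-cong λ i → trans (cong (μ i *_) (p≡x+sw i j))
        (trans (distribˡ (μ i) (x j) _) (cong (μ i * x j +_) (sym (*-assoc _ _ _)))))
      (trans (sum-+ {3} (λ i → μ i * x j) (λ i → μ i * s i * w j))
        (trans (cong₂ _+_ (trans (sum-*ʳ (x j) μ) (trans (cong (_* x j) Σμ≡0) (zeroˡ _)))
          (trans (sum-*ʳ {3} (w j) (λ i → μ i * s i)) (trans (cong (_* w j) Σμs≡0) (zeroˡ _))))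
          (+-identityˡ 0#)))

    zeros : ∀ {a b c} → a ≡ 0# → b ≡ 0# → c ≡ 0# → a + (b + c) ≡ 0#
    zeros refl refl refl = trans (cong (0# +_) (+-identityˡ 0#)) (+-identityˡ 0#)

    *-cancels : ∀ a b → a * (b - b) ≡ 0#
    *-cancels a b = trans (cong (a *_) (-‿inverseʳ b)) (zeroʳ a)

    -- Up to sign the cross product of (1, 1, 1) and `s`, hence orthogonal to both. Independence
    -- makes it 0, so `s₀` equals `s₁`, and then (1, -1, 0) is a dependence that is visibly nonzero.
    μ : Fin 3 → Carrier
    μ = (s₁ - s₂) ∷ (s₂ - s₀) ∷ (s₀ - s₁) ∷ []

    μ≡0 : ∀ i → μ i ≡ 0#
    μ≡0 = independent μ
      -- Negatives and 0 enter as free variables; the sum is regrouped into pairs of a number and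
      -- its negative, which cancel afterwards.
      (trans (solve 7 (λ a b c a′ b′ c′ o →
          (b :+ c′) :+ ((c :+ a′) :+ ((a :+ b′) :+ o)) := o :+ ((a :+ a′) :+ ((b :+ b′) :+ (c :+ c′))))
          refl s₀ s₁ s₂ (- s₀) (- s₁) (- s₂) 0#)
        (trans (+-identityˡ _) (zeros (-‿inverseʳ s₀) (-‿inverseʳ s₁) (-‿inverseʳ s₂))))
      (trans (solve 7 (λ a b c a′ b′ c′ o →
          (b :+ c′) :* a :+ ((c :+ a′) :* b :+ ((a :+ b′) :* c :+ o))
          := o :+ (b :* (a :+ a′) :+ (c :* (b :+ b′) :+ a :* (c :+ c′))))
          refl s₀ s₁ s₂ (- s₀) (- s₁) (- s₂) 0#)
        (trans (+-identityˡ _) (zeros (*-cancels s₁ s₀) (*-cancels s₂ s₁) (*-cancels s₀ s₂))))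

    s₀≡s₁ : s₀ ≡ s₁
    s₀≡s₁ = x-y≡0⇒x≡y s₀ s₁ (μ≡0 (suc (suc zero)))

    μ′ : Fin 3 → Carrier
    μ′ = 1# ∷ (- 1#) ∷ 0# ∷ []

    Σμ′≡0 : sum μ′ ≡ 0#
    Σμ′≡0 = trans (cong (λ z → 1# + (- 1# + z)) (+-identityˡ 0#))
      (trans (cong (1# +_) (+-identityʳ _)) (-‿inverseʳ 1#))

    Σμ′s≡0 : sum (λ i → μ′ i * s i) ≡ 0#
    Σμ′s≡0 = trans (cong₂ _+_ (trans (*-identityˡ s₀) s₀≡s₁)
      (trans (cong₂ _+_ (-1*x≈-x s₁) (trans (+-identityʳ _) (zeroˡ s₂))) (+-identityʳ _)))
      (-‿inverseʳ s₁)

  -- Vertices, edges and 2-faces.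

  IsVertex-cong : ∀ {p q} → p ≋ q → IsVertex V p → IsVertex V q
  IsVertex-cong e (G , p∈G , uniq) = G , ∈F-cong G e p∈G , λ x x∈G → ≋-trans (uniq x x∈G) e

  -- The weights of `v` sum to 1, so one of them is nonzero, and its `V i` lies on the face that
  -- isolates `v`. This ties vertices to a finite index set, for maximisation and for induction.
  vertexIndex : ∀ {v} → IsVertex V v → ∃ λ i → V i ≋ v
  vertexIndex {v} (G , v∈G@(v∈P@(μ , 0≤μ , Σμ≡1 , _) , _) , uniq)
    with any? (λ i → ¬? (0≟ (μ i)))
  ... | yes (i , μᵢ≢0) = i , uniq (V i) (slack≡0⇒∈F G (V∈P i) (*-zero-cancelˡ μᵢ≢0
    (⟦⟧-support (slack G) (λ i → slack-nonneg G (V∈P i)) v∈P (∈F⇒slack≡0 G v∈G) i)))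
  ... | no ∄ = contradiction (trans (sym (sum-zero λ i → decidable-stable (0≟ (μ i)) λ ne → ∄ (i , ne))) Σμ≡1) 0≢1

  Adjacent-sym : ∀ {p q} → Adjacent V p q → Adjacent V q p
  Adjacent-sym (vp , vq , p≉q , E , dim , p∈E , q∈E) = vq , vp , p≉q ∘ ≋-sym , E , dim , q∈E , p∈E

  Adjacent-congʳ : ∀ {p q r} → q ≋ r → Adjacent V p q → Adjacent V p r
  Adjacent-congʳ e (vp , vq , p≉q , E , dim , p∈E , q∈E) =
    vp , IsVertex-cong e vq , (λ p≋r → p≉q (≋-trans p≋r (≋-sym e))) , E , dim , p∈E , ∈F-cong E e q∈E

  private
    sum-drop₁ : ∀ {a b c : Carrier} → a ≡ 0# → a + (b + (c + 0#)) ≡ 0# → b + c ≡ 0#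
    sum-drop₁ {b = b} {c} refl e = trans (sym (trans (+-identityˡ _) (cong (b +_) (+-identityʳ c)))) e

    sum-drop₂ : ∀ {a b c : Carrier} → b ≡ 0# → a + (b + (c + 0#)) ≡ 0# → a + c ≡ 0#
    sum-drop₂ {a} {c = c} refl e = trans (cong (a +_) (sym (trans (+-identityˡ _) (+-identityʳ c)))) e

    sum-drop₃ : ∀ {a b c : Carrier} → c ≡ 0# → a + (b + (c + 0#)) ≡ 0# → a + b ≡ 0#
    sum-drop₃ {a} {b} refl e = trans (cong (a +_) (sym (trans (cong (b +_) (+-identityˡ 0#)) (+-identityʳ b)))) e

  vertex∈P : ∀ {v} → IsVertex V v → InP V v
  vertex∈P (_ , (v∈P , _) , _) = v∈P

  vertex-slack-pos : ∀ {v x} ((G , _) : IsVertex V v) → InP V x → ¬ v ≋ x → 0# < ⟦ slack G ⟧ x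
  vertex-slack-pos (G , _ , uniq) x∈P v≉x = ∉F⇒0<slack G x∈P λ x∈G → v≉x (≋-sym (uniq _ x∈G))

  -- The slack of the face isolating one vertex vanishes there and is positive at the other two,
  -- whose coefficients in a dependence therefore have opposite signs. This holds for each pair,
  -- which forces all three to be 0.
  vertices-AffIndep : ∀ {p q r} → IsVertex V p → IsVertex V q → IsVertex V r →
    ¬ p ≋ q → ¬ p ≋ r → ¬ q ≋ r → AffIndep (p ∷ q ∷ r ∷ [])
  vertices-AffIndep {p} {q} {r} vp vq vr p≉q p≉r q≉r μ Σμ≡0 Σμp≡0 =
    λ { zero → proj₁ μ≡0 ; (suc zero) → proj₁ (proj₂ μ≡0) ; (suc (suc zero)) → proj₂ (proj₂ μ≡0) }
    where
    dependence : ∀ {x} ((G , _) : IsVertex V x) → sum (λ i → μ i * ⟦ slack G ⟧ ((p ∷ q ∷ r ∷ []) i)) ≡ 0#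
    dependence (G , _) = ⟦⟧-dependence (slack G) μ (p ∷ q ∷ r ∷ []) Σμ≡0 Σμp≡0

    own : ∀ {x} a ((G , _) : IsVertex V x) → a * ⟦ slack G ⟧ x ≡ 0#
    own a (G , x∈G , _) = trans (cong (a *_) (∈F⇒slack≡0 G x∈G)) (zeroʳ a)

    positive : ∀ {x y} ((G , _) : IsVertex V x) → IsVertex V y → ¬ x ≋ y → 0# < ⟦ slack G ⟧ y
    positive vx vy = vertex-slack-pos vx (vertex∈P vy)

    μ≡0 = pairwise-opposite⇒0
      (positive vp vq p≉q) (positive vp vr p≉r)
      (positive vq vp (p≉q ∘ ≋-sym)) (positive vq vr q≉r)
      (positive vr vp (p≉r ∘ ≋-sym)) (positive vr vq (q≉r ∘ ≋-sym))
      (sum-drop₁ (own _ vp) (dependence vp))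
      (sum-drop₂ (own _ vq) (dependence vq))
      (sum-drop₃ (own _ vr) (dependence vr))

  edge-vertices : ∀ {E : Face V} → HasDim E 1 → ∀ {p q r} → IsVertex V p → IsVertex V q → IsVertex V r →
    p ∈F E → q ∈F E → r ∈F E → ¬ p ≋ q → ¬ p ≋ r → q ≋ r
  edge-vertices (_ , no-triangle) {p} {q} {r} vp vq vr p∈E q∈E r∈E p≉q p≉r =
    decidable-stable (q ≋? r) λ q≉r → no-triangle (p ∷ q ∷ r ∷ [])
      (λ { zero → p∈E ; (suc zero) → q∈E ; (suc (suc zero)) → r∈E })
      (vertices-AffIndep vp vq vr p≉q p≉r q≉r)

  -- The same sign argument with edges at `x`: the slack of one edge vanishes at both its ends and
  -- is positive at the other two neighbours. Three distinct neighbours would thus give four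
  -- independent points in `F`.
  no-three-neighbours : ∀ {F : Face V} → HasDim F 2 → ∀ {x a b c} → x ∈F F → a ∈F F → b ∈F F → c ∈F F →
    Adjacent V x a → Adjacent V x b → Adjacent V x c → ¬ a ≋ b → ¬ a ≋ c → b ≋ c
  no-three-neighbours {F} (_ , no-tetrahedron) {x} {a} {b} {c} x∈F a∈F b∈F c∈F xa xb xc a≉b a≉c =
    decidable-stable (b ≋? c) λ b≉c → no-tetrahedron (x ∷ a ∷ b ∷ c ∷ [])
      (λ { zero → x∈F ; (suc zero) → a∈F ; (suc (suc zero)) → b∈F ; (suc (suc (suc zero))) → c∈F })
      (independent b≉c)
    where
    edge : ∀ {y} → Adjacent V x y → Face V
    edge (_ , _ , _ , E , _) = E

    positive : ∀ {y z} (xy : Adjacent V x y) → Adjacent V x z → ¬ y ≋ z → 0# < ⟦ slack (edge xy) ⟧ z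
    positive (vx , vy , x≉y , E , dim , x∈E , y∈E) (_ , vz , x≉z , _) y≉z =
      ∉F⇒0<slack E (vertex∈P vz) λ z∈E → y≉z (edge-vertices {E} dim vx vy vz x∈E y∈E z∈E x≉y x≉z)

    independent : ¬ b ≋ c → AffIndep (x ∷ a ∷ b ∷ c ∷ [])
    independent b≉c μ Σμ≡0 Σμp≡0 =
      λ { zero → trans (sym (trans (cong (μ zero +_) (sum-zero abc≡0)) (+-identityʳ _))) Σμ≡0
        ; (suc i) → abc≡0 i }
      where
      start : ∀ {y} k (xy : Adjacent V x y) → k * ⟦ slack (edge xy) ⟧ x ≡ 0#
      start k (_ , _ , _ , E , _ , x∈E , _) = trans (cong (k *_) (∈F⇒slack≡0 E x∈E)) (zeroʳ k)

      end : ∀ {y} k (xy : Adjacent V x y) → k * ⟦ slack (edge xy) ⟧ y ≡ 0#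
      end k (_ , _ , _ , E , _ , _ , y∈E) = trans (cong (k *_) (∈F⇒slack≡0 E y∈E)) (zeroʳ k)

      dependence : ∀ {y} (xy : Adjacent V x y) →
        sum (λ i → μ (suc i) * ⟦ slack (edge xy) ⟧ ((a ∷ b ∷ c ∷ []) i)) ≡ 0#
      dependence xy = trans (sym (trans (cong (_+ sum (λ i → μ (suc i) * ⟦ slack (edge xy) ⟧ ((a ∷ b ∷ c ∷ []) i)))
          (start (μ zero) xy)) (+-identityˡ _)))
        (⟦⟧-dependence (slack (edge xy)) μ (x ∷ a ∷ b ∷ c ∷ []) Σμ≡0 Σμp≡0)

      abc = pairwise-opposite⇒0
        (positive xa xb a≉b) (positive xa xc a≉c)
        (positive xb xa (a≉b ∘ ≋-sym)) (positive xb xc b≉c)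
        (positive xc xa (a≉c ∘ ≋-sym)) (positive xc xb (b≉c ∘ ≋-sym))
        (sum-drop₁ (end _ xa) (dependence xa))
        (sum-drop₂ (end _ xb) (dependence xb))
        (sum-drop₃ (end _ xc) (dependence xc))

      abc≡0 : ∀ i → μ (suc i) ≡ 0#
      abc≡0 zero             = proj₁ abc
      abc≡0 (suc zero)       = proj₁ (proj₂ abc)
      abc≡0 (suc (suc zero)) = proj₂ (proj₂ abc)

  -- A point of `F` off `G` is separated from `p`, `q`, `r` by the slack of `G`, which would make
  -- four independent points in `F`.
  2-face-⊆ : ∀ {F : Face V} → HasDim F 2 → ∀ (G : Face V) {p q r} →
    p ∈F F → q ∈F F → r ∈F F → p ∈F G → q ∈F G → r ∈F G → AffIndep (p ∷ q ∷ r ∷ []) → F ⊆F G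
  2-face-⊆ (_ , no-tetrahedron) G {p} {q} {r} p∈F q∈F r∈F p∈G q∈G r∈G indep x x∈F =
    slack≡0⇒∈F G (proj₁ x∈F) (decidable-stable (0≟ _) λ slack≢0 →
      no-tetrahedron (x ∷ p ∷ q ∷ r ∷ [])
        (λ { zero → x∈F ; (suc zero) → p∈F ; (suc (suc zero)) → q∈F ; (suc (suc (suc zero))) → r∈F })
        (AffIndep-∷ {p = p ∷ q ∷ r ∷ []} (slack G)
          (λ { zero → ∈F⇒slack≡0 G p∈G ; (suc zero) → ∈F⇒slack≡0 G q∈G ; (suc (suc zero)) → ∈F⇒slack≡0 G r∈G })
          slack≢0 indep))

  -- Improving edges at a vertex of a 2-face.

  module VertexOf2Face {F : Face V} (dim : HasDim F 2) {x} (vx : IsVertex V x) (x∈F : x ∈F F) where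
    private
      -- A height above `x`: on `P` it vanishes at `x` alone. It is the denominator of all slopes.
      g : Affine
      g = slack (proj₁ vx)

      gx≡0 : ⟦ g ⟧ x ≡ 0#
      gx≡0 = ∈F⇒slack≡0 (proj₁ vx) (proj₁ (proj₂ vx))

      0≤gV : ∀ i → 0# ≤ ⟦ g ⟧ (V i)
      0≤gV i = slack-nonneg (proj₁ vx) (V∈P i)

      g≡0⇒≋x : ∀ i → ⟦ g ⟧ (V i) ≡ 0# → V i ≋ x
      g≡0⇒≋x i e = proj₂ (proj₂ vx) (V i) (slack≡0⇒∈F (proj₁ vx) (V∈P i) e)

      -- Equality of the slopes `h / g` at `V i` and `V k`, cross-multiplied because `g` may vanish
      -- there.
      Proportional : Affine → Fin m → Fin m → Set
      Proportional h i k = ⟦ h ⟧ (V i) * ⟦ g ⟧ (V k) ≡ ⟦ h ⟧ (V k) * ⟦ g ⟧ (V i)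

      x≉ : ∀ l → ¬ ⟦ g ⟧ (V l) ≡ 0# → ¬ x ≋ V l
      x≉ l ne e = ne (trans (⟦⟧-cong g (≋-sym e)) gx≡0)

    -- `θ` cuts a face `E` out of `F`. It contains `x` and `V s`, while three independent points in
    -- it and `V l` would be four in `F`; so `E` is an edge. The neighbour of `x` is the listed
    -- point of `E` with the largest `g`.
    edgeAlong : ∀ θ → (∀ i → V i ∈F F → 0# ≤ ⟦ θ ⟧ (V i)) → ⟦ θ ⟧ x ≡ 0# →
      ∀ s → V s ∈F F → ⟦ θ ⟧ (V s) ≡ 0# → ¬ ⟦ g ⟧ (V s) ≡ 0# →
      ∀ l → V l ∈F F → ¬ ⟦ θ ⟧ (V l) ≡ 0# →
      ∃ λ j → V j ∈F F × Adjacent V x (V j) × ⟦ θ ⟧ (V j) ≡ 0# × 0# < ⟦ g ⟧ (V j)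
    edgeAlong θ 0≤θ θx≡0 s Vs∈F θVs≡0 gVs≢0 l Vl∈F θVl≢0 =
      j , proj₁ (E-out Vj∈E) , (vx , vj , x≉Vj , E , dimE , x∈E , Vj∈E) , proj₂ (E-out Vj∈E) , 0<gVj
      where
      face-E = subface F θ 0≤θ
      E = proj₁ face-E
      E-in = proj₁ (proj₂ face-E)
      E-out = proj₂ (proj₂ face-E)

      x∈E : x ∈F E
      x∈E = E-in x∈F θx≡0

      Vs∈E : V s ∈F E
      Vs∈E = E-in Vs∈F θVs≡0

      dimE : HasDim E 1
      dimE = (x ∷ V s ∷ [] , (λ { zero → x∈E ; (suc zero) → Vs∈E }) , AffIndep-pair (x≉ s gVs≢0))
        , λ p p∈E indep →
            proj₂ dim (V l ∷ p) (λ { zero → Vl∈F ; (suc i) → proj₁ (E-out (p∈E i)) })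
              (AffIndep-∷ θ (λ i → proj₂ (E-out (p∈E i))) θVl≢0 indep)

      farthest = maximize (∈F? E) (λ l → ⟦ g ⟧ (V l)) (s , Vs∈E)
      j = proj₁ farthest
      Vj∈E = proj₁ (proj₂ farthest)
      γ = ⟦ g ⟧ (V j)

      0<gVj : 0# < γ
      0<gVj = <-≤-trans (0≤gV s , gVs≢0 ∘ sym) (proj₂ (proj₂ farthest) s Vs∈E)

      x≉Vj : ¬ x ≋ V j
      x≉Vj = x≉ j (proj₂ 0<gVj ∘ sym)

      -- Nonnegative on `E` and 0 at `V j`, hence a certificate that `V j` is a vertex: a second
      -- zero would form, with `V j` and `x`, three independent points on the edge.
      η : Affine
      η = const γ ⊕ ⊖ g

      ⟦η⟧ : ∀ p → ⟦ η ⟧ p ≡ γ - ⟦ g ⟧ p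
      ⟦η⟧ p = trans (⟦⊕⟧ (const γ) (⊖ g) p) (cong₂ _+_ (⟦const⟧ γ p) (⟦⊖⟧ g p))

      ηVj≡0 : ⟦ η ⟧ (V j) ≡ 0#
      ηVj≡0 = trans (⟦η⟧ (V j)) (-‿inverseʳ γ)

      ηx≢0 : ¬ ⟦ η ⟧ x ≡ 0#
      ηx≢0 e = proj₂ 0<gVj (trans (sym gx≡0) (sym (x-y≡0⇒x≡y _ _ (trans (sym (⟦η⟧ x)) e))))

      face-Vj = subface E η λ l Vl∈E →
        subst (0# ≤_) (sym (⟦η⟧ (V l))) (x≤y⇒0≤y-x (proj₂ (proj₂ farthest) l Vl∈E))

      vj : IsVertex V (V j)
      vj = proj₁ face-Vj , proj₁ (proj₂ face-Vj) Vj∈E ηVj≡0 , λ p p∈ →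
        let p∈E , ηp≡0 = proj₂ (proj₂ face-Vj) p∈ in
        decidable-stable (p ≋? V j) λ p≉Vj → proj₂ dimE (x ∷ p ∷ V j ∷ [])
          (λ { zero → x∈E ; (suc zero) → p∈E ; (suc (suc zero)) → Vj∈E })
          (AffIndep-∷ {p = p ∷ V j ∷ []} η (λ { zero → ηp≡0 ; (suc zero) → ηVj≡0 }) ηx≢0 (AffIndep-pair p≉Vj))

    -- Among the points of F, an edge at x maximises the slope h / g.
    steepestEdge : ∀ h → ⟦ h ⟧ x ≡ 0# → ∀ i k → V i ∈F F → V k ∈F F → ¬ Proportional h i k →
      ∃ λ ρ → ∃ λ j → (∀ l → V l ∈F F → ⟦ h ⟧ (V l) ≤ ρ * ⟦ g ⟧ (V l)) ×
        V j ∈F F × Adjacent V x (V j) × ⟦ h ⟧ (V j) ≡ ρ * ⟦ g ⟧ (V j) × 0# < ⟦ g ⟧ (V j)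
    steepestEdge h hx≡0 i k Vi∈F Vk∈F ∝̸ = from-maximum
      (maximize (λ l → ∈F? F l ×-dec ¬? (0≟ (⟦ g ⟧ (V l)))) slope (i , Vi∈F , gVi≢0))
      where
      h≡0 : ∀ l → ⟦ g ⟧ (V l) ≡ 0# → ⟦ h ⟧ (V l) ≡ 0#
      h≡0 l e = trans (⟦⟧-cong h (g≡0⇒≋x l e)) hx≡0

      gVi≢0 : ¬ ⟦ g ⟧ (V i) ≡ 0#
      gVi≢0 e = ∝̸ (trans (cong (_* ⟦ g ⟧ (V k)) (h≡0 i e)) (trans (zeroˡ _)
        (sym (trans (cong (⟦ h ⟧ (V k) *_) e) (zeroʳ _)))))

      slope : Fin m → Carrier
      slope l = ⟦ h ⟧ (V l) * inv (⟦ g ⟧ (V l))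

      module _ (ρ : Carrier) where
        -- Nonnegative on `F` once `ρ` is the largest slope, and 0 where that slope is attained.
        θ : Affine
        θ = ρ ⊛ g ⊕ ⊖ h

        ⟦θ⟧ : ∀ p → ⟦ θ ⟧ p ≡ ρ * ⟦ g ⟧ p - ⟦ h ⟧ p
        ⟦θ⟧ p = trans (⟦⊕⟧ (ρ ⊛ g) (⊖ h) p) (cong₂ _+_ (⟦⊛⟧ ρ g p) (⟦⊖⟧ h p))

        θ≡0 : ∀ {p} → ⟦ h ⟧ p ≡ ρ * ⟦ g ⟧ p → ⟦ θ ⟧ p ≡ 0#
        θ≡0 {p} e = trans (⟦θ⟧ p) (trans (cong (λ z → ρ * ⟦ g ⟧ p - z) e) (-‿inverseʳ _))

        θ≡0⇒h≡ρg : ∀ {p} → ⟦ θ ⟧ p ≡ 0# → ⟦ h ⟧ p ≡ ρ * ⟦ g ⟧ p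
        θ≡0⇒h≡ρg {p} e = sym (x-y≡0⇒x≡y _ _ (trans (sym (⟦θ⟧ p)) e))

        both-θ≡0⇒∝ : ⟦ θ ⟧ (V i) ≡ 0# → ⟦ θ ⟧ (V k) ≡ 0# → Proportional h i k
        both-θ≡0⇒∝ e e′ = begin
          ⟦ h ⟧ (V i) * gₖ  ≡⟨ cong (_* gₖ) (θ≡0⇒h≡ρg e) ⟩
          ρ * gᵢ * gₖ       ≡⟨ *-assoc ρ gᵢ gₖ ⟩
          ρ * (gᵢ * gₖ)     ≡⟨ cong (ρ *_) (*-comm gᵢ gₖ) ⟩
          ρ * (gₖ * gᵢ)     ≡⟨ *-assoc ρ gₖ gᵢ ⟨
          ρ * gₖ * gᵢ       ≡⟨ cong (_* gᵢ) (θ≡0⇒h≡ρg e′) ⟨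
          ⟦ h ⟧ (V k) * gᵢ  ∎
          where
          open ≡-Reasoning
          gᵢ = ⟦ g ⟧ (V i)
          gₖ = ⟦ g ⟧ (V k)

        -- `θ` cannot vanish at both `V i` and `V k`, for `h` is not proportional to `g` there; so
        -- its zero set is not all of `F`.
        off-edge : Dec (⟦ θ ⟧ (V i) ≡ 0#) → ∃ λ l → V l ∈F F × ¬ ⟦ θ ⟧ (V l) ≡ 0#
        off-edge (no ne) = i , Vi∈F , ne
        off-edge (yes e) = k , Vk∈F , λ e′ → ∝̸ (both-θ≡0⇒∝ e e′)

        along : (∀ l → V l ∈F F → ⟦ h ⟧ (V l) ≤ ρ * ⟦ g ⟧ (V l)) →
          ∀ s → V s ∈F F → ¬ ⟦ g ⟧ (V s) ≡ 0# → ⟦ h ⟧ (V s) ≡ ρ * ⟦ g ⟧ (V s) →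
          ∃ λ j → V j ∈F F × Adjacent V x (V j) × ⟦ h ⟧ (V j) ≡ ρ * ⟦ g ⟧ (V j) × 0# < ⟦ g ⟧ (V j)
        along h≤ρg s Vs∈F gVs≢0 hVs≡ρg =
          let l , Vl∈F , θVl≢0 = off-edge (0≟ (⟦ θ ⟧ (V i)))
              j , Vj∈F , x-Vj , θVj≡0 , 0<gVj = edgeAlong θ
                (λ l Vl∈F → subst (0# ≤_) (sym (⟦θ⟧ (V l))) (x≤y⇒0≤y-x (h≤ρg l Vl∈F)))
                (θ≡0 (trans hx≡0 (sym (trans (cong (ρ *_) gx≡0) (zeroʳ ρ)))))
                s Vs∈F (θ≡0 hVs≡ρg) gVs≢0 l Vl∈F θVl≢0
          in j , Vj∈F , x-Vj , θ≡0⇒h≡ρg θVj≡0 , 0<gVj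

      from-maximum : (∃ λ s → (V s ∈F F × ¬ ⟦ g ⟧ (V s) ≡ 0#) ×
        (∀ l → V l ∈F F × ¬ ⟦ g ⟧ (V l) ≡ 0# → slope l ≤ slope s)) → _
      from-maximum (s , (Vs∈F , gVs≢0) , max) =
        let j , Vj = along (slope s) h≤ρg s Vs∈F gVs≢0 (sym (y*inv[x]*x≡y _ gVs≢0))
        in slope s , j , h≤ρg , Vj
        where
        -- Points where `g` is 0 are copies of `x`, left out of the maximum; at them both sides are
        -- 0.
        h≤ρg′ : ∀ l → V l ∈F F → Dec (⟦ g ⟧ (V l) ≡ 0#) → ⟦ h ⟧ (V l) ≤ slope s * ⟦ g ⟧ (V l)
        h≤ρg′ l Vl∈F (yes e) = ≤-reflexive (trans (h≡0 l e) (sym (trans (cong (slope s *_) e) (zeroʳ _))))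
        h≤ρg′ l Vl∈F (no ne) = subst (_≤ slope s * ⟦ g ⟧ (V l)) (y*inv[x]*x≡y _ ne)
          (*-monoʳ-≤ (0≤gV l) (max l (Vl∈F , ne)))

        h≤ρg : ∀ l → V l ∈F F → ⟦ h ⟧ (V l) ≤ slope s * ⟦ g ⟧ (V l)
        h≤ρg l Vl∈F = h≤ρg′ l Vl∈F (0≟ (⟦ g ⟧ (V l)))

    -- The largest slope `ρ` is positive, because `h` is positive at `V k` and at most `ρ` times `g`
    -- there; so `h` is positive at the end of a steepest edge. If `h` is a multiple of `g` on `F`,
    -- all slopes agree and single out no edge, whence the separate case.
    improvingNeighbour : ∀ h → ⟦ h ⟧ x ≡ 0# → ∀ k → V k ∈F F → 0# < ⟦ h ⟧ (V k) →
      ∃ λ j → V j ∈F F × Adjacent V x (V j) × 0# < ⟦ h ⟧ (V j)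
    improvingNeighbour h hx≡0 k Vk∈F 0<hVk =
      by-slope (any? λ i → ∈F? F i ×-dec ¬? (proportional? h i))
      where
      0<gVk : 0# < ⟦ g ⟧ (V k)
      0<gVk = 0≤gV k , λ e → proj₂ 0<hVk (sym (trans (⟦⟧-cong h (g≡0⇒≋x k (sym e))) hx≡0))

      proportional? : ∀ φ i → Dec (Proportional φ i k)
      proportional? φ i = (⟦ φ ⟧ (V i) * ⟦ g ⟧ (V k)) ≟ (⟦ φ ⟧ (V k) * ⟦ g ⟧ (V i))

      -- If every coordinate relative to `x` were a multiple of `g`, all of `F` would lie on the
      -- line through `x` and `V k`, against dimension 2.
      collinear : (∀ l i → V i ∈F F → Proportional (coordinate l x) i k) → ⊥
      collinear ∝ = case proj₁ dim of λ (p , p∈F , indep) →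
        collinear⇒¬AffIndep x (λ l → κVk l) (λ i → ⟦ g ⟧ (p i) * inv (⟦ g ⟧ (V k)))
          (λ i l → on-line l (p∈F i)) indep
        where
        open ≡-Reasoning
        gₖ = ⟦ g ⟧ (V k)

        κVk : Fin d → Carrier
        κVk l = ⟦ coordinate l x ⟧ (V k)

        module _ (l : Fin d) where
          κ = coordinate l x
          χ = gₖ ⊛ κ ⊕ ⊖ (κVk l ⊛ g)

          ⟦χ⟧ : ∀ p → ⟦ χ ⟧ p ≡ ⟦ κ ⟧ p * gₖ - κVk l * ⟦ g ⟧ p
          ⟦χ⟧ p = trans (⟦⊕⟧ (gₖ ⊛ κ) _ p) (cong₂ _+_ (trans (⟦⊛⟧ gₖ κ p) (*-comm _ _))
            (trans (⟦⊖⟧ (κVk l ⊛ g) p) (cong -_ (⟦⊛⟧ (κVk l) g p))))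

          χ≡0 : ∀ {p} → p ∈F F → ⟦ χ ⟧ p ≡ 0#
          χ≡0 = V-zero⇒F-zero F χ λ i Vi∈F → trans (⟦χ⟧ (V i))
            (trans (cong (_- κVk l * ⟦ g ⟧ (V i)) (∝ l i Vi∈F)) (-‿inverseʳ _))

          on-line : ∀ {p} → p ∈F F → p l ≡ x l + ⟦ g ⟧ p * inv gₖ * κVk l
          on-line {p} p∈F = begin
            p l                               ≡⟨ x-y+y≡x (p l) (x l) ⟨
            p l - x l + x l                   ≡⟨ +-comm _ (x l) ⟩
            x l + (p l - x l)                 ≡⟨ cong (x l +_) (⟦coordinate⟧ l x p) ⟨
            x l + ⟦ κ ⟧ p                     ≡⟨ cong (x l +_) κp≡ ⟩
            x l + ⟦ g ⟧ p * inv gₖ * κVk l    ∎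
            where
            κp≡ : ⟦ κ ⟧ p ≡ ⟦ g ⟧ p * inv gₖ * κVk l
            κp≡ = begin
              ⟦ κ ⟧ p                        ≡⟨ *-identityʳ _ ⟨
              ⟦ κ ⟧ p * 1#                   ≡⟨ cong (⟦ κ ⟧ p *_) (x*inv[x]≡1 (proj₂ 0<gVk ∘ sym)) ⟨
              ⟦ κ ⟧ p * (gₖ * inv gₖ)        ≡⟨ *-assoc _ _ _ ⟨
              ⟦ κ ⟧ p * gₖ * inv gₖ          ≡⟨ cong (_* inv gₖ)
                (x-y≡0⇒x≡y _ _ (trans (sym (⟦χ⟧ p)) (χ≡0 p∈F))) ⟩
              κVk l * ⟦ g ⟧ p * inv gₖ       ≡⟨ *-assoc _ _ _ ⟩
              κVk l * (⟦ g ⟧ p * inv gₖ)     ≡⟨ *-comm _ _ ⟩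
              ⟦ g ⟧ p * inv gₖ * κVk l       ∎

      -- If h is proportional to g on F, then every edge at x improves h, and it
      -- only remains to find one; some coordinate is not proportional to g.
      by-coordinate : (∀ i → V i ∈F F → Proportional h i k) →
        Dec (∃ λ l → ∃ λ i → V i ∈F F × ¬ Proportional (coordinate l x) i k) →
        ∃ λ j → V j ∈F F × Adjacent V x (V j) × 0# < ⟦ h ⟧ (V j)
      by-coordinate ∝ (yes (l , i , Vi∈F , ∝̸)) =
        let _ , j , _ , Vj∈F , x-Vj , _ , 0<gVj = steepestEdge (coordinate l x)
              (trans (⟦coordinate⟧ l x x) (-‿inverseʳ (x l))) i k Vi∈F Vk∈F ∝̸
        in j , Vj∈F , x-Vj , *-pos-cancelʳ (proj₁ 0<gVk)
             (subst (0# <_) (sym (∝ j Vj∈F)) (*-pos 0<hVk 0<gVj))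
      by-coordinate ∝ (no ∄) = ⊥-elim (collinear λ l i Vi∈F →
        decidable-stable (proportional? (coordinate l x) i) λ ∝̸ → ∄ (l , i , Vi∈F , ∝̸))

      by-slope : Dec (∃ λ i → V i ∈F F × ¬ Proportional h i k) →
        ∃ λ j → V j ∈F F × Adjacent V x (V j) × 0# < ⟦ h ⟧ (V j)
      by-slope (yes (i , Vi∈F , ∝̸)) =
        let ρ , j , h≤ρg , Vj∈F , x-Vj , hVj≡ , 0<gVj = steepestEdge h hx≡0 i k Vi∈F Vk∈F ∝̸
        in j , Vj∈F , x-Vj , subst (0# <_) (sym hVj≡)
             (*-pos (*-pos-cancelʳ (0≤gV k) (<-≤-trans 0<hVk (h≤ρg k Vk∈F))) 0<gVj)
      by-slope (no ∄) = by-coordinate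
        (λ i Vi∈F → decidable-stable (proportional? h i) λ ∝̸ → ∄ (i , Vi∈F , ∝̸))
        (any? λ l → any? λ i → ∈F? F i ×-dec ¬? (proportional? (coordinate l x) i))

-- The lattice: covers, costs and well-founded induction.

module PseudoJoin (K : OrderedField) {d m : ℕ} (V : Fin m → Geom.Pt K d) (c : Geom.Pt K d)
  (simple : Geom.IsSimple K V) (generic : Geom.IsGeneric K V c)
  (L : Lattice 0ℓ 0ℓ 0ℓ) (ι : Lattice.Carrier L → Geom.Pt K d)
  (hasse : IsHasseDiagramOf K V c L ι) where
  open OrderedField K using (Carrier; _+_; -_) renaming (_≤_ to _≤ₖ_)
  open OrderedFieldProperties K
  open Geom K renaming (_<_ to _<ₖ_)
  open PolytopeGeometry K V
  open Affine
  open Lattice L using (_≈_; _≤_; _∨_; module Eq; reflexive; x≤x∨y; y≤x∨y; ∨-least)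
    renaming (Carrier to El; trans to ≤L-trans; refl to ≤L-refl; antisym to ≤L-antisym)

  vertex : ∀ a → IsVertex V (ι a)
  vertex = proj₁ hasse

  element : ∀ v → IsVertex V v → ∃ λ a → ι a ≋ v
  element = proj₁ (proj₂ hasse)

  ≈⇒≋ : ∀ {a b} → a ≈ b → ι a ≋ ι b
  ≈⇒≋ = proj₁ (proj₂ (proj₂ hasse)) _ _

  ≋⇒≈ : ∀ {a b} → ι a ≋ ι b → a ≈ b
  ≋⇒≈ = proj₁ (proj₂ (proj₂ (proj₂ hasse))) _ _

  _≈?_ : ∀ a b → Dec (a ≈ b)
  a ≈? b with ι a ≋? ι b
  ... | yes e = yes (≋⇒≈ e)
  ... | no ne = no (ne ∘ ≈⇒≋)

  cover⇒edge : ∀ {a b} → Covers L a b → DirEdge V c (ι a) (ι b)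
  cover⇒edge = proj₁ (proj₂ (proj₂ (proj₂ (proj₂ hasse))) _ _)

  edge⇒cover : ∀ {a b} → DirEdge V c (ι a) (ι b) → Covers L a b
  edge⇒cover = proj₂ (proj₂ (proj₂ (proj₂ (proj₂ hasse))) _ _)

  cover⇒≤ : ∀ {a b} → Covers L a b → a ≤ b
  cover⇒≤ ((a≤b , _) , _) = a≤b

  cover-respʳ : ∀ {a b b′} → b ≈ b′ → Covers L a b → Covers L a b′
  cover-respʳ e ((a≤b , a≉b) , between) =
    (≤L-trans a≤b (reflexive e) , λ a≈b′ → a≉b (Eq.trans a≈b′ (Eq.sym e)))
    , λ z a≤z z≤b′ → case between z a≤z (≤L-trans z≤b′ (reflexive (Eq.sym e))) of λ
      { (inj₁ z≈a) → inj₁ z≈a ; (inj₂ z≈b) → inj₂ (Eq.trans z≈b e) }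

  covers-antichain : ∀ {a b p} → Covers L a b → Covers L a p → p ≤ b → p ≈ b
  covers-antichain (_ , between) ((a≤p , a≉p) , _) p≤b with between _ a≤p p≤b
  ... | inj₁ p≈a = contradiction (Eq.sym p≈a) a≉p
  ... | inj₂ p≈b = p≈b

  cost : El → Carrier
  cost a = c · ι a

  cover⇒cost< : ∀ {a b} → Covers L a b → cost a <ₖ cost b
  cover⇒cost< ab = proj₂ (cover⇒edge ab)

  cost<⇒≉ : ∀ {a b} → cost a <ₖ cost b → ¬ ι a ≋ ι b
  cost<⇒≉ (_ , ne) e = ne (·-cong c e)

  cost≤∧≉⇒cost< : ∀ {a b} → cost a ≤ₖ cost b → ¬ a ≈ b → cost a <ₖ cost b
  cost≤∧≉⇒cost< le a≉b = le , λ e → a≉b (≋⇒≈ (generic _ _ (vertex _) (vertex _) e))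

  <ₖ-trans : ∀ {x y z} → x <ₖ y → y <ₖ z → x <ₖ z
  <ₖ-trans p q = <-≤-trans p (proj₁ q)

  index : El → Fin m
  index a = proj₁ (vertexIndex (vertex a))

  V-index : ∀ a → V (index a) ≋ ι a
  V-index a = proj₂ (vertexIndex (vertex a))

  _≻_ : El → El → Set
  a ≻ b = cost b <ₖ cost a

  -- Each vertex is some `V i`, so the costs take finitely many values.
  ≻-wellFounded : WellFounded _≻_
  ≻-wellFounded = Subrelation.wellFounded
    (λ {a} {b} → subst₂ _<ₖ_ (·-cong c (≋-sym (V-index b))) (·-cong c (≋-sym (V-index a))))
    (On.wellFounded index (spo-wellFounded {_⊏_ = λ i j → c · V j <ₖ c · V i} record
      { isEquivalence = isEquivalence
      ; irrefl        = λ { refl → <-irrefl }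
      ; trans         = λ p q → <ₖ-trans q p
      ; <-resp-≈      = resp₂ _
      }))

  _≺_ : El → El → Set
  a ≺ b = a ≤ b × ¬ a ≈ b

  -- Cost does not serve here: it is only known to grow along covers, and finding a cover below a
  -- given larger element is what this induction is for.
  ≺-wellFounded : WellFounded _≺_
  ≺-wellFounded = Subrelation.wellFounded
    (λ {a} {b} a≺b → a , b , V-index a , V-index b , a≺b)
    (On.wellFounded index (spo-wellFounded {_⊏_ = _⊏_} record
      { isEquivalence = isEquivalence
      ; irrefl        = λ { refl (a , b , a~ , b~ , _ , a≉b) → a≉b (≋⇒≈ (≋-trans (≋-sym a~) b~)) }
      ; trans         = λ { (a , b , a~ , b~ , a≤b , a≉b) (b′ , e , b′~ , e~ , b′≤e , b′≉e) →
          let b≈b′ = ≋⇒≈ (≋-trans (≋-sym b~) b′~)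
              b≤e  = ≤L-trans (reflexive b≈b′) b′≤e
          in a , e , a~ , e~ , ≤L-trans a≤b b≤e
             , λ a≈e → a≉b (≤L-antisym a≤b (≤L-trans b≤e (reflexive (Eq.sym a≈e)))) }
      ; <-resp-≈      = resp₂ _
      }))
    where
    -- The element at `V i` is unique only up to `≈`, and a `V i` that is no vertex has none, so the
    -- order is carried to indices by an existential.
    _⊏_ : Fin m → Fin m → Set
    i ⊏ j = ∃ λ a → ∃ λ b → V i ≋ ι a × V j ≋ ι b × a ≺ b

  -- If there were none, no `e` with `a ≺ e` and `e ≤ b` could exist: by induction nothing lies
  -- strictly between `a` and `e`, so `e` itself would be a cover.
  ¬¬cover-below : ∀ {a b} → a ≺ b → ¬ ¬ (∃ λ p → Covers L a p × p ≤ b)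
  ¬¬cover-below {a} {b} a≺b ∄ = search b (≺-wellFounded b) a≺b ≤L-refl
    where
    search : ∀ e → Acc _≺_ e → a ≺ e → e ≤ b → ⊥
    search e (acc rs) a≺e e≤b = ∄ (e , (a≺e , between) , e≤b)
      where
      between : ∀ z → a ≤ z → z ≤ e → z ≈ a ⊎ z ≈ e
      between z a≤z z≤e with z ≈? a | z ≈? e
      ... | yes z≈a | _       = inj₁ z≈a
      ... | no _    | yes z≈e = inj₂ z≈e
      ... | no z≉a  | no z≉e  =
        ⊥-elim (search z (rs (z≤e , z≉e)) (a≤z , z≉a ∘ Eq.sym) (≤L-trans z≤e e≤b))

  -- 2-faces seen from the lattice.

  infix 4 _∈ᴱ_
  _∈ᴱ_ : El → Face V → Set
  a ∈ᴱ F = ι a ∈F F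

  Top : Face V → El → Set
  Top F v = v ∈ᴱ F × (∀ b → b ∈ᴱ F → cost b ≤ₖ cost v)

  ¬¬top : ∀ {F a} → a ∈ᴱ F → ¬ ¬ ∃ (Top F)
  ¬¬top {F} a∈F ∄ = climb _ (≻-wellFounded _) a∈F
    where
    climb : ∀ a → Acc _≻_ a → a ∈ᴱ F → ⊥
    climb a (acc rs) a∈F = ∄ (a , a∈F , λ b b∈F → case ≤-or-> (cost b) (cost a) of λ
      { (inj₁ le) → le ; (inj₂ gt) → ⊥-elim (climb b (rs gt) b∈F) })

  -- Simplicity enters here, for two edges at `ι a`.
  2-face-at : ∀ {a b p} → Covers L a b → Covers L a p → ¬ b ≈ p →
    Σ (Face V) λ F → HasDim F 2 × a ∈ᴱ F × b ∈ᴱ F × p ∈ᴱ F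
  2-face-at {a} {b} {p} ab ap b≉p =
    let F , dim , a∈F , nbrs∈F = simple (ι a) (vertex a) 2 (ι b ∷ ι p ∷ []) distinct adjacent
    in F , dim , a∈F , nbrs∈F zero , nbrs∈F (suc zero)
    where
    distinct : ∀ j k → (ι b ∷ ι p ∷ []) j ≋ (ι b ∷ ι p ∷ []) k → j ≡ k
    distinct zero       zero       e = refl
    distinct zero       (suc zero) e = contradiction (≋⇒≈ e) b≉p
    distinct (suc zero) zero       e = contradiction (≋⇒≈ (≋-sym e)) b≉p
    distinct (suc zero) (suc zero) e = refl

    adjacent : ∀ j → Adjacent V (ι a) ((ι b ∷ ι p ∷ []) j)
    adjacent zero       = proj₁ (cover⇒edge ab)
    adjacent (suc zero) = proj₁ (cover⇒edge ap)

  module In2Face {F : Face V} (dim : HasDim F 2) where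

    -- `b` only certifies that `a` is not the sink of `F`; the cover found may be another vertex.
    up : ∀ {a b} → a ∈ᴱ F → b ∈ᴱ F → cost a <ₖ cost b → ∃ λ a′ → a′ ∈ᴱ F × Covers L a a′
    up {a} {b} a∈F b∈F a<b =
      let j , Vj∈F , adj , 0<hVj = VertexOf2Face.improvingNeighbour {F} dim (vertex a) a∈F
            (centred c (ι a)) (-‿inverseʳ (cost a)) (index b) (∈F-cong F (≋-sym (V-index b)) b∈F)
            (x<y⇒0<y-x (subst (cost a <ₖ_) (·-cong c (≋-sym (V-index b))) a<b))
          a′ , a′≋Vj = element (V j) (proj₁ (proj₂ adj))
      in a′ , ∈F-cong F (≋-sym a′≋Vj) Vj∈F
         , edge⇒cover (Adjacent-congʳ (≋-sym a′≋Vj) adj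
             , subst (cost a <ₖ_) (·-cong c (≋-sym a′≋Vj)) (0<y-x⇒x<y 0<hVj))

    down : ∀ {a b} → a ∈ᴱ F → b ∈ᴱ F → cost b <ₖ cost a → ∃ λ a′ → a′ ∈ᴱ F × Covers L a′ a
    down {a} {b} a∈F b∈F b<a =
      let j , Vj∈F , adj , 0<hVj = VertexOf2Face.improvingNeighbour {F} dim (vertex a) a∈F
            (⊖ centred c (ι a))
            (trans (⟦⊖⟧ (centred c (ι a)) (ι a)) (trans (cong -_ (-‿inverseʳ (cost a))) -0#≈0#))
            (index b) (∈F-cong F (≋-sym (V-index b)) b∈F)
            (subst (_ <ₖ_) (sym (⟦⊖centred⟧ (V (index b))))
              (x<y⇒0<y-x (subst (_<ₖ cost a) (·-cong c (≋-sym (V-index b))) b<a)))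
          a′ , a′≋Vj = element (V j) (proj₁ (proj₂ adj))
      in a′ , ∈F-cong F (≋-sym a′≋Vj) Vj∈F
         , edge⇒cover (Adjacent-sym (Adjacent-congʳ (≋-sym a′≋Vj) adj)
             , subst (_<ₖ cost a) (·-cong c (≋-sym a′≋Vj))
                 (0<y-x⇒x<y (subst (_ <ₖ_) (⟦⊖centred⟧ (V j)) 0<hVj)))
      where
      ⟦⊖centred⟧ : ∀ p → ⟦ ⊖ centred c (ι a) ⟧ p ≡ cost a - c · p
      ⟦⊖centred⟧ p = trans (⟦⊖⟧ (centred c (ι a)) p) (trans (sym (-‿+-comm (c · p) (- cost a)))
        (trans (+-comm _ _) (cong (_- c · p) (-‿involutive (cost a)))))

    -- As `e` has smaller cost, `a` also has a lower neighbour in `F`; two distinct covers would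
    -- make three neighbours in a 2-face.
    unique-cover : ∀ {a b p e} → a ∈ᴱ F → b ∈ᴱ F → p ∈ᴱ F → e ∈ᴱ F → cost e <ₖ cost a →
      Covers L a b → Covers L a p → p ≈ b
    unique-cover a∈F b∈F p∈F e∈F e<a ab ap =
      let f , f∈F , fa = down a∈F e∈F e<a
          below : ∀ {x} → Covers L _ x → ¬ ι f ≋ ι x
          below ax = cost<⇒≉ (<ₖ-trans (cover⇒cost< fa) (cover⇒cost< ax))
      in ≋⇒≈ (no-three-neighbours {F} dim a∈F f∈F p∈F b∈F
           (Adjacent-sym (proj₁ (cover⇒edge fa))) (proj₁ (cover⇒edge ap)) (proj₁ (cover⇒edge ab))
           (below ap) (below ab))

    unique-cocover : ∀ {a b p e} → a ∈ᴱ F → b ∈ᴱ F → p ∈ᴱ F → e ∈ᴱ F → cost a <ₖ cost e →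
      Covers L b a → Covers L p a → p ≈ b
    unique-cocover a∈F b∈F p∈F e∈F a<e ba pa =
      let f , f∈F , af = up a∈F e∈F a<e
          above : ∀ {x} → Covers L x _ → ¬ ι f ≋ ι x
          above xa = cost<⇒≉ (<ₖ-trans (cover⇒cost< xa) (cover⇒cost< af)) ∘ ≋-sym
      in ≋⇒≈ (no-three-neighbours {F} dim a∈F f∈F p∈F b∈F
           (proj₁ (cover⇒edge af)) (Adjacent-sym (proj₁ (cover⇒edge pa))) (Adjacent-sym (proj₁ (cover⇒edge ba)))
           (above pa) (above ba))

    -- Climbs along edges of `F`. Each is a cover, so a comparison of costs becomes one in the
    -- lattice.
    ≤-top : ∀ {v} → Top F v → ∀ a → a ∈ᴱ F → a ≤ v
    ≤-top {v} (v∈F , max) a a∈F = climb a (≻-wellFounded a) a∈F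
      where
      climb : ∀ a → Acc _≻_ a → a ∈ᴱ F → a ≤ v
      climb a (acc rs) a∈F with a ≈? v
      ... | yes a≈v = reflexive a≈v
      ... | no a≉v =
        let b , b∈F , ab = up a∈F v∈F (cost≤∧≉⇒cost< (max a a∈F) a≉v)
        in ≤L-trans (cover⇒≤ ab) (climb b (rs (cover⇒cost< ab)) b∈F)

  -- The trace of a chain from `z` to `q` in `F`. Only its last step, from `r` to `q`, is kept: the
  -- chains from `x` and from `y` are compared there.
  ReachedIn : Face V → El → El → Set
  ReachedIn F z q = q ∈ᴱ F × (¬ q ≈ z → ∃ λ r → r ∈ᴱ F × z ≤ r × Covers L r q)

  JoinProperty : El → Set
  JoinProperty u = ∀ F → HasDim F 2 → ∀ {x y v} → u ∈ᴱ F → x ∈ᴱ F → y ∈ᴱ F →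
    Covers L u x → Covers L u y → ¬ x ≈ y → Top F v → v ≈ x ∨ y

  -- Intervals below the sink of a 2-face.

  module _ {F : Face V} (dim : HasDim F 2) {u v : El} (u∈F : u ∈ᴱ F) (top : Top F v)
    (ih : ∀ {a} → cost u <ₖ cost a → JoinProperty a) where
    open In2Face {F} dim

    v∈F : v ∈ᴱ F
    v∈F = proj₁ top

    -- Suppose p ≉ b, and let F′ be the 2-face spanned by a, b, p. Its sink is
    -- b ∨ p ≤ v, so F′ provides a cover p′ ≤ v of b. By induction p′ is the
    -- cover of b in F, so F and F′ share a, b, p′ and hence coincide; but F
    -- cannot contain p as well.
    cover-in-F : ∀ {a} → Acc _≻_ a → a ∈ᴱ F → cost u <ₖ cost a →
      ∀ {b p} → b ∈ᴱ F → Covers L a b → Covers L a p → p ≤ v → p ≈ b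
    cover-in-F {a} (acc rs) a∈F u<a {b} {p} b∈F ab ap p≤v =
      decidable-stable (p ≈? b) λ p≉b → absurd p≉b (2-face-at ab ap (p≉b ∘ Eq.sym))
      where
      b≤v : b ≤ v
      b≤v = ≤-top top b b∈F

      absurd : ¬ p ≈ b → ¬ (Σ (Face V) λ F′ → HasDim F′ 2 × a ∈ᴱ F′ × b ∈ᴱ F′ × p ∈ᴱ F′)
      absurd p≉b (F′ , dim′ , a∈F′ , b∈F′ , p∈F′) = ¬¬top {F′} a∈F′ λ { (t , t-top) →
        let t≈b∨p = ih u<a F′ dim′ a∈F′ b∈F′ p∈F′ ab ap (p≉b ∘ Eq.sym) t-top
            t≤v   = ≤L-trans (reflexive t≈b∨p) (∨-least b≤v p≤v)
            p≤t   = ≤L-trans (y≤x∨y b p) (reflexive (Eq.sym t≈b∨p))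
            -- Otherwise `p ≤ b`, but distinct covers of `a` are incomparable. The same argument
            -- excludes `b ≈ v`.
            b≉t   = λ b≈t → p≉b (covers-antichain ab ap (≤L-trans p≤t (reflexive (Eq.sym b≈t))))
            b≉v   = λ b≈v → p≉b (covers-antichain ab ap (≤L-trans p≤v (reflexive (Eq.sym b≈v))))
            b′ , b′∈F , bb′ = up b∈F v∈F (cost≤∧≉⇒cost< (proj₂ top b b∈F) b≉v)
            p′ , p′∈F′ , bp′ = In2Face.up {F′} dim′ b∈F′ (proj₁ t-top)
              (cost≤∧≉⇒cost< (proj₂ t-top b b∈F′) b≉t)
            p′≤v  = ≤L-trans (In2Face.≤-top {F′} dim′ t-top p′ p′∈F′) t≤v
            a<b   = cover⇒cost< ab
            p′≈b′ = cover-in-F (rs a<b) b∈F (<ₖ-trans u<a a<b) b′∈F bb′ bp′ p′≤v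
            b<p′  = cover⇒cost< bp′
            F′⊆F  = 2-face-⊆ {F′} dim′ F
              a∈F′ b∈F′ p′∈F′ a∈F b∈F (∈F-cong F (≋-sym (≈⇒≋ p′≈b′)) b′∈F)
              (vertices-AffIndep (vertex a) (vertex b) (vertex p′)
                (cost<⇒≉ a<b) (cost<⇒≉ (<ₖ-trans a<b b<p′)) (cost<⇒≉ b<p′))
        -- `u` lies in `F` and has smaller cost than `a`, so `a` has only one cover in `F`.
        in p≉b (unique-cover a∈F b∈F (F′⊆F _ p∈F′) u∈F u<a ab ap) }

    -- A cover of `z` below `q` lies in `F` by `cover-in-F`, and the induction goes on from there.
    -- The double negation comes from `¬¬cover-below`.
    interval-in-F : ∀ {z} → Acc _≻_ z → z ∈ᴱ F → cost u <ₖ cost z →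
      ∀ {q} → z ≤ q → q ≤ v → ¬ ¬ ReachedIn F z q
    interval-in-F {z} (acc rs) z∈F u<z {q} z≤q q≤v ∄ with q ≈? z
    ... | yes q≈z = ∄ (∈F-cong F (≋-sym (≈⇒≋ q≈z)) z∈F , λ q≉z → contradiction q≈z q≉z)
    ... | no q≉z = ¬¬cover-below (z≤q , q≉z ∘ Eq.sym) λ { (p , zp , p≤q) →
      let z≉v = λ z≈v → q≉z (≤L-antisym (≤L-trans q≤v (reflexive (Eq.sym z≈v))) z≤q)
          b , b∈F , zb = up z∈F v∈F (cost≤∧≉⇒cost< (proj₂ top z z∈F) z≉v)
          p≈b = cover-in-F (acc rs) z∈F u<z b∈F zb zp (≤L-trans p≤q q≤v)
          p∈F = ∈F-cong F (≋-sym (≈⇒≋ p≈b)) b∈F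
          z<p = cover⇒cost< zp
      in interval-in-F (rs z<p) p∈F (<ₖ-trans u<z z<p) p≤q q≤v λ { (q∈F , step) →
        ∄ (q∈F , λ _ → extend zp step (q ≈? p)) } }
      where
      extend : ∀ {p} → Covers L z p → (¬ q ≈ p → ∃ λ r → r ∈ᴱ F × p ≤ r × Covers L r q) →
        Dec (q ≈ p) → ∃ λ r → r ∈ᴱ F × z ≤ r × Covers L r q
      extend zp step (yes q≈p) = z , z∈F , ≤L-refl , cover-respʳ (Eq.sym q≈p) zp
      extend zp step (no q≉p)  =
        let r , r∈F , p≤r , rq = step q≉p in r , r∈F , ≤L-trans (cover⇒≤ zp) p≤r , rq

  -- Joins and pseudo-joins.

  joinProperty : ∀ {u} → Acc _≻_ u → JoinProperty u
  joinProperty {u} (acc rs) F dim {x} {y} {v} u∈F x∈F y∈F ux uy x≉y top =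
    decidable-stable (v ≈? (x ∨ y)) λ v≉w →
      interval (x≤x∨y x y) ux x∈F λ (w∈F , stepx) →
      interval (y≤x∨y x y) uy y∈F λ (_ , stepy) →
      -- Here `w` stands for `x ∨ y`. If it were `x`, then `y ≤ x`, impossible for distinct covers
      -- of `u`; so the chain from `x` has a last step, and likewise the chain from `y`.
      let r  , r∈F  , x≤r  , rw  = stepx λ w≈x →
            x≉y (Eq.sym (covers-antichain ux uy (≤L-trans (y≤x∨y x y) (reflexive w≈x))))
          r′ , r′∈F , y≤r′ , r′w = stepy λ w≈y →
            x≉y (covers-antichain uy ux (≤L-trans (x≤x∨y x y) (reflexive w≈y)))
          w<v = cost≤∧≉⇒cost< (proj₂ top _ w∈F) (v≉w ∘ Eq.sym)
          r′≈r = unique-cocover w∈F r∈F r′∈F (proj₁ top) w<v rw r′w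
          -- With `r′ ≈ r`, the element `r` bounds both `x` and `y`, yet it lies strictly below
          -- their join.
          w≤r = ∨-least x≤r (≤L-trans y≤r′ (reflexive r′≈r))
      in proj₂ (proj₁ rw) (≤L-antisym (cover⇒≤ rw) w≤r)
    where
    open In2Face {F} dim

    w≤v : x ∨ y ≤ v
    w≤v = ∨-least (≤-top top x x∈F) (≤-top top y y∈F)

    interval : ∀ {z} → z ≤ x ∨ y → Covers L u z → z ∈ᴱ F → ¬ ¬ ReachedIn F z (x ∨ y)
    interval z≤w uz z∈F = interval-in-F {F} dim u∈F top (λ u<a → joinProperty (rs u<a))
      (≻-wellFounded _) z∈F (cover⇒cost< uz) z≤w w≤v

  -- For distinct `x` and `y` the faces `F` and `G` have the same points, one inclusion by
  -- minimality of `G` and the other by dimension. The case `x ≈ y` is allowed too; there `G` lies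
  -- in the edge from `u` to `x`, and its sink is `x`.
  pseudoJoin≡join : ∀ (F : Face V) → HasDim F 2 → ∀ {u x y} → u ∈ᴱ F → x ∈ᴱ F → y ∈ᴱ F →
    Covers L u x → Covers L u y → ∀ (G : Face V) →
    IsSmallestFaceContaining (triple (ι u) (ι x) (ι y)) G →
    ∀ s → IsSink c G s → s ≋ ι (x ∨ y)
  pseudoJoin≡join F dim {u} {x} {y} u∈F x∈F y∈F ux uy G (p∈G , least) s (vs , s∈G , max)
    with x ≈? y
  ... | yes x≈y = ≋-trans (≋-sym x≋s) (≈⇒≋ (≤L-antisym (x≤x∨y x y) (∨-least ≤L-refl (reflexive (Eq.sym x≈y)))))
    where
    E-edge = proj₂ (proj₂ (proj₂ (proj₁ (cover⇒edge ux))))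
    E = proj₁ E-edge
    u∈E = proj₁ (proj₂ (proj₂ E-edge))
    x∈E = proj₂ (proj₂ (proj₂ E-edge))

    s∈E : s ∈F E
    s∈E = least E (λ { zero → u∈E ; (suc zero) → x∈E ; (suc (suc zero)) → ∈F-cong E (≈⇒≋ x≈y) x∈E }) s s∈G

    u<s : c · ι u <ₖ c · s
    u<s = <-≤-trans (cover⇒cost< ux) (max (ι x) (vertex x) (p∈G (suc zero)))

    x≋s : ι x ≋ s
    x≋s = edge-vertices {E} (proj₁ (proj₂ E-edge)) (vertex u) (vertex x) vs u∈E x∈E s∈E
      (cost<⇒≉ (cover⇒cost< ux)) λ u≋s → proj₂ u<s (·-cong c u≋s)
  ... | no x≉y =
    let t , t≋s = element s vs
        t-top : Top F t
        t-top = ∈F-cong F (≋-sym t≋s) s∈F , λ b b∈F →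
          subst (cost b ≤ₖ_) (·-cong c (≋-sym t≋s)) (max (ι b) (vertex b) (F⊆G (ι b) b∈F))
    in ≋-trans (≋-sym t≋s) (≈⇒≋ (joinProperty (≻-wellFounded u) F dim u∈F x∈F y∈F ux uy x≉y t-top))
    where
    s∈F : s ∈F F
    s∈F = least F (λ { zero → u∈F ; (suc zero) → x∈F ; (suc (suc zero)) → y∈F }) s s∈G

    F⊆G : F ⊆F G
    F⊆G = 2-face-⊆ {F} dim G
      u∈F x∈F y∈F (p∈G zero) (p∈G (suc zero)) (p∈G (suc (suc zero)))
      (vertices-AffIndep (vertex u) (vertex x) (vertex y)
        (cost<⇒≉ (cover⇒cost< ux)) (cost<⇒≉ (cover⇒cost< uy)) (x≉y ∘ ≋⇒≈))

-- Duality, from joins to meets.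

dualLattice : Lattice 0ℓ 0ℓ 0ℓ → Lattice 0ℓ 0ℓ 0ℓ
dualLattice L = record
  { _∨_ = _∧_
  ; _∧_ = _∨_
  ; isLattice = record
    { isPartialOrder = PosetProperties.≥-isPartialOrder poset
    ; supremum = infimum
    ; infimum = supremum
    }
  }
  where open Lattice L using (_∨_; _∧_; supremum; infimum; poset)

theorem4p6 : (K : OrderedField) → let open Geom K in
    ∀ {d m : ℕ} (V : Fin m → Pt d) (c : Pt d) →
    IsSimple V → IsGeneric V c →
    (L : Lattice 0ℓ 0ℓ 0ℓ) (ι : Lattice.Carrier L → Pt d) →
    IsHasseDiagramOf K V c L ι →
    (∀ (F : Face V) → HasDim F 2 → ∀ (u x y : Lattice.Carrier L) →
    IsSource c F (ι u) → ι x ∈F F → ι y ∈F F →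
    Covers L u x → Covers L u y →
    ∀ (G : Face V) →
    IsSmallestFaceContaining (triple (ι u) (ι x) (ι y)) G →
    ∀ s → IsSink c G s → s ≋ ι (Lattice._∨_ L x y))
    ×
    (∀ (F : Face V) → HasDim F 2 → ∀ (v x y : Lattice.Carrier L) →
    IsSink c F (ι v) → ι x ∈F F → ι y ∈F F →
    Covers L x v → Covers L y v →
    ∀ (G : Face V) →
    IsSmallestFaceContaining (triple (ι v) (ι x) (ι y)) G →
    ∀ s → IsSource c G s → s ≋ ι (Lattice._∧_ L x y))
theorem4p6 K {d} {m} V c simple generic L ι hasse@(vertex , element , ≈⇒≋ , ≋⇒≈ , covers) =
    (λ F dim u x y (_ , u∈F , _) x∈F y∈F ux uy →
      PseudoJoin.pseudoJoin≡join K V c simple generic L ι hasse F dim u∈F x∈F y∈F ux uy)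
  -- Negating the cost reverses all edges, which gives the Hasse diagram of the dual lattice, whose
  -- join is the meet of `L`. A source for `c` is a sink for `-c`.
  , (λ F dim v x y (_ , v∈F , _) x∈F y∈F xv yv G smallest s (vs , s∈G , min) →
      PseudoJoin.pseudoJoin≡join K V -c simple generic′ (dualLattice L) ι hasse′
        F dim v∈F x∈F y∈F (flip-cover xv) (flip-cover yv) G smallest s
        (vs , s∈G , λ w vw w∈G → subst₂ _≤_ (sym (neg-· c w)) (sym (neg-· c s)) (neg-antimono-≤ (min w vw w∈G))))
  where
  open OrderedField K using (_≤_; -_)
  open OrderedFieldProperties K
  open Geom K
  open PolytopeGeometry K V

  -c : Pt d
  -c j = - c j

  generic′ : IsGeneric V -c
  generic′ p q vp vq e = generic p q vp vq (trans (sym (-‿involutive _))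
    (trans (cong -_ (trans (sym (neg-· c p)) (trans e (neg-· c q)))) (-‿involutive _)))

  flip-cover : ∀ {a b} → Covers L a b → Covers (dualLattice L) b a
  flip-cover ((a≤b , a≉b) , between) = (a≤b , a≉b ∘ Lattice.Eq.sym L)
    , λ z z≤b a≤z → swap (between z a≤z z≤b)

  unflip-cover : ∀ {a b} → Covers (dualLattice L) b a → Covers L a b
  unflip-cover ((a≤b , b≉a) , between) = (a≤b , b≉a ∘ Lattice.Eq.sym L)
    , λ z a≤z z≤b → swap (between z z≤b a≤z)

  flip-edge : ∀ {p q} → DirEdge V c p q → DirEdge V -c q p
  flip-edge {p} {q} (adj , p<q) = Adjacent-sym adj ,
    subst₂ _<_ (sym (neg-· c q)) (sym (neg-· c p)) (neg-antimono-< p<q)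

  unflip-edge : ∀ {p q} → DirEdge V -c q p → DirEdge V c p q
  unflip-edge {p} {q} (adj , q<p) = Adjacent-sym adj , subst₂ _<_ (-‿involutive _) (-‿involutive _)
    (neg-antimono-< (subst₂ _<_ (neg-· c q) (neg-· c p) q<p))

  hasse′ : IsHasseDiagramOf K V -c (dualLattice L) ι
  hasse′ = vertex , element , ≈⇒≋ , ≋⇒≈ , λ a b →
    flip-edge ∘ proj₁ (covers b a) ∘ unflip-cover , flip-cover ∘ proj₂ (covers b a) ∘ unflip-edge
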